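{- Let $\Lambda\subset\mathbb{Q}^2$ be a rational lattice. There is an algorithm that, given $n>0$, a point $\mathbf p\in H_n$, and the standard basis $\mathbf b_1,\mathbf b_2$ of $\Lambda$, computes $\mathrm{Nextpt}(\mathbf p)$. If $\Lambda$ is a reduced sublattice of $\mathbb{Z}^2$, the number of arithmetic operations taken by the algorithm is in $O(\log(n+\det\Lambda))$, except possibly when $\mathbf p_y\in(1,2)$.
   Context: $H_n:=\{(x,y)\in\mathbb{R}_{\ge0}^2: xy\ge n\}$ and $H_{n,\mathbf p+\Lambda}:=H_n\cap(\mathbf p+\Lambda)$. The standard basis of $\Lambda$ is the basis $\mathbf b_1,\mathbf b_2=(0,(\mathbf b_2)_y)$ with $(\mathbf b_1)_x>0$, $(\mathbf b_2)_y>0$, $0\le(\mathbf b_1)_y<(\mathbf b_2)_y$. A sublattice $\Lambda\subseteq\mathbb{Z}^2$ is reduced if both coordinate projections of $\Lambda$ equal $\mathbb{Z}$. $\mathrm{Minsl}(\mathbf p)$ is the primitive nonzero vector of $\Lambda$ of smallest slope (vertical downward vectors having slope $-\infty$) among directions of nonzero vectors in $(H_{n,\mathbf p+\Lambda}-\mathbf p)\cap\{x\ge0\}$; $\mathrm{Nextpt}(\mathbf p):=\mathbf p+k\,\mathrm{Minsl}(\mathbf p)$ with $k=\max\{j\in\mathbb{Z}:\mathbf p+j\,\mathrm{Minsl}(\mathbf p)\in H_n\}$, and $\mathrm{Nextpt}(\mathbf p)=\infty$ if $k=\infty$. Arithmetic model: comparisons, $+,-,\times$, integer division and integer square root cost 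$O(1)$.
   Formalization: The number n and the coordinates of the point p in H_n are taken to be rational rather than real. -}

module Defs where

open import Data.Bool using (Bool; true; false; if_then_else_)
open import Data.Nat as ℕ using (ℕ; zero; suc)
import Data.Nat.DivMod as ℕD
open import Data.Nat.Logarithm using (⌊log₂_⌋)
open import Data.Integer as ℤ using (ℤ; +_)
open import Data.Rational as ℚ using (ℚ; 0ℚ; 1ℚ; _≟_; ↥_; ↧ₙ_; floor; ceiling; _≤ᵇ_)
import Data.Rational.Properties as ℚP
open import Data.Product using (Σ; ∃; ∃-syntax; _×_; _,_; proj₁; proj₂)
open import Data.Sum using (_⊎_; inj₁; inj₂)
open import Data.Maybe using (Maybe; just; nothing)
open import Data.Vec using (Vec; []; _∷_)
open import Relation.Nullary using (¬_; yes; no)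
open import Relation.Binary.PropositionalEquality using (_≡_; _≢_)

Pt : Set
Pt = ℚ × ℚ

_⊕_ : Pt → Pt → Pt
(a , b) ⊕ (c , d) = (a ℚ.+ c , b ℚ.+ d)

_⊛_ : ℚ → Pt → Pt
c ⊛ (a , b) = (c ℚ.* a , c ℚ.* b)

zℚ : ℤ → ℚ
zℚ z = z ℚ./ 1

record Basis : Set where
  constructor basis
  field
    b1x b1y b2y : ℚ

open Basis public

b₁ b₂ : Basis → Pt
b₁ B = (b1x B , b1y B)
b₂ B = (0ℚ , b2y B)

IsStandardBasis : Basis → Set
IsStandardBasis B = (0ℚ ℚ.< b1x B) × (0ℚ ℚ.< b2y B) × (0ℚ ℚ.≤ b1y B) × (b1y B ℚ.< b2y B)

InΛ : Basis → Pt → Set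
InΛ B v = ∃[ a ] ∃[ c ] (v ≡ (zℚ a ⊛ b₁ B) ⊕ (zℚ c ⊛ b₂ B))

detΛ : Basis → ℚ
detΛ B = b1x B ℚ.* b2y B

IsIntegral : ℚ → Set
IsIntegral q = ∃[ z ] (q ≡ zℚ z)

Reduced : Basis → Set
Reduced B =
  (∀ v → InΛ B v → IsIntegral (proj₁ v) × IsIntegral (proj₂ v))
  × (∀ (m : ℤ) → ∃[ v ] (InΛ B v × proj₁ v ≡ zℚ m))
  × (∀ (m : ℤ) → ∃[ v ] (InΛ B v × proj₂ v ≡ zℚ m))

InH : ℚ → Pt → Set
InH n (x , y) = (0ℚ ℚ.≤ x) × (0ℚ ℚ.≤ y) × (n ℚ.≤ x ℚ.* y)

InS : ℚ → Basis → Pt → Pt → Set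
InS n B p w = InΛ B w × (w ≢ (0ℚ , 0ℚ)) × (0ℚ ℚ.≤ proj₁ w) × InH n (p ⊕ w)

Primitive : Basis → Pt → Set
Primitive B v = InΛ B v × (v ≢ (0ℚ , 0ℚ))
  × (∀ u (m : ℤ) → InΛ B u → v ≡ zℚ m ⊛ u → (m ≡ + 1) ⊎ (m ≡ ℤ.- (+ 1)))

-- For nonzero vectors v, w with vₓ ≥ 0, wₓ ≥ 0 (vertical downward = slope −∞,
-- vertical upward = slope +∞): slope v ≤ slope w  iff  vₓ w_y − v_y wₓ ≥ 0.
SlopeLE : Pt → Pt → Set
SlopeLE (vx , vy) (wx , wy) = 0ℚ ℚ.≤ (vx ℚ.* wy ℚ.- vy ℚ.* wx)

IsMinsl : ℚ → Basis → Pt → Pt → Set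
IsMinsl n B p v = Primitive B v
  × (∃[ w ] ∃[ c ] (InS n B p w × 0ℚ ℚ.< c × w ≡ c ⊛ v))
  × (∀ w → InS n B p w → SlopeLE v w)

-- Nextpt(p) = just q, or nothing standing for ∞
IsNextpt : ℚ → Basis → Pt → Maybe Pt → Set
IsNextpt n B p (just q) = ∃[ v ] (IsMinsl n B p v ×
  ∃[ k ] (q ≡ p ⊕ (zℚ k ⊛ v) × InH n q
          × (∀ (j : ℤ) → InH n (p ⊕ (zℚ j ⊛ v)) → j ℤ.≤ k)))
IsNextpt n B p nothing = ∃[ v ] (IsMinsl n B p v ×
  (∀ (j : ℤ) → ∃[ j' ] (j ℤ.≤ j' × InH n (p ⊕ (zℚ j' ⊛ v)))))

-- Arithmetic model of computation.
-- A program manipulates values of an abstract type V; it may only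
-- use the primitive operations below (each costs 1):
--   + − × , integer division ⌊x/y⌋, integer square root ⌊√x⌋,
--   integer constants, and comparison x ≤ y.

data BinOp : Set where
  add sub mul fdiv : BinOp

data Prog (V R : Set) : Set where
  ret   : R → Prog V R
  bin   : BinOp → V → V → (V → Prog V R) → Prog V R
  sqrtᵢ : V → (V → Prog V R) → Prog V R
  lit   : ℤ → (V → Prog V R) → Prog V R
  leq   : V → V → (Bool → Prog V R) → Prog V R

-- An algorithm: a fixed number k of registers, an initialisation program
-- reading the 6 inputs (n , pₓ , p_y , (b₁)ₓ , (b₁)_y , (b₂)_y), and a loop body
-- that either updates the registers or halts with an output
-- (nothing = ∞, just (x , y) = the point (x , y)).
-- Programs are polymorphic in the value type V, so they can only access
-- values through the primitive operations.
record Algorithm : Set₁ where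
  field
    k    : ℕ
    init : ∀ {V : Set} → Vec V 6 → Prog V (Vec V k)
    body : ∀ {V : Set} → Vec V k → Prog V (Vec V k ⊎ Maybe (V × V))

open Algorithm public

isqrtℕ : ℕ → ℕ
isqrtℕ n = go n
  where
  go : ℕ → ℕ
  go zero    = zero
  go (suc r) = if (suc r ℕ.* suc r) ℕ.≤ᵇ n then suc r else go r

-- ⌊ x / y ⌋ (0 if y = 0)
fdivℚ : ℚ → ℚ → ℚ
fdivℚ x y with y ≟ 0ℚ
... | yes _  = 0ℚ
... | no y≢0 = zℚ (floor (ℚ._÷_ x y {{ℚ.≢-nonZero y≢0}}))

-- ⌊ √x ⌋ (0 if x < 0); for x = a/b ≥ 0, ⌊√(a/b)⌋ = ⌊ ⌊√(ab)⌋ / b ⌋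
isqrtℚ : ℚ → ℚ
isqrtℚ x with ↥ x
... | ℤ.-[1+ _ ] = 0ℚ
... | + a = zℚ (+ (isqrtℕ (a ℕ.* ↧ₙ x) ℕD./ ↧ₙ x))

evalBin : BinOp → ℚ → ℚ → ℚ
evalBin add x y = x ℚ.+ y
evalBin sub x y = x ℚ.- y
evalBin mul x y = x ℚ.* y
evalBin fdiv x y = fdivℚ x y

exec : ∀ {R} → Prog ℚ R → R × ℕ
exec (ret r) = r , 0
exec (bin o x y κ) with exec (κ (evalBin o x y))
... | r , c = r , suc c
exec (sqrtᵢ x κ) with exec (κ (isqrtℚ x))
... | r , c = r , suc c
exec (lit z κ) with exec (κ (zℚ z))
... | r , c = r , suc c
exec (leq x y κ) with exec (κ (x ≤ᵇ y))
... | r , c = r , suc c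

loop : (A : Algorithm) → ℕ → Vec ℚ (k A) → ℕ → Maybe (Maybe Pt × ℕ)
loop A zero s acc = nothing
loop A (suc fuel) s acc with exec (body A s)
... | inj₁ s' , c = loop A fuel s' (acc ℕ.+ c)
... | inj₂ out , c = just (out , acc ℕ.+ c)

run : (A : Algorithm) → ℕ → Vec ℚ 6 → Maybe (Maybe Pt × ℕ)
run A fuel inp with exec (init A inp)
... | s , c = loop A fuel s c

Runs : Algorithm → Vec ℚ 6 → Maybe Pt → ℕ → Set
Runs A inp out cost = ∃[ fuel ] (run A fuel inp ≡ just (out , cost))

inputs : ℚ → Pt → Basis → Vec ℚ 6
inputs n (px , py) B = n ∷ px ∷ py ∷ b1x B ∷ b1y B ∷ b2y B ∷ []

logSize : ℚ → Basis → ℕ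
logSize n B = ⌊log₂ ℤ.∣ ceiling (n ℚ.+ detΛ B) ∣ ⌋

{-# OPTIONS --safe #-}
module Submission where

-- Keep a basis u, v of Λ with 0 ≤ u_x < v_x and det (u, v) > 0 such that p + v
-- lies in H_n while p + u and p + u + v do not.  By convexity of H_n, v is
-- Minsl(p) as soon as no p + u + t v lies in H_n: a point p + α u + β v of H_n
-- with α ≥ 1 would force one with α = 1.  Otherwise take the least such t, put
-- v′ = u + t v and u′ = v′ − v, and slide v′ along u′ as long as it stays in H_n;
-- the result is again such a basis.  Since t ≥ 2, while v_y ≥ 0 the number |u_y|
-- is at least halved, as in Euclid's algorithm, and once v_y < 0 the number |v_y|,
-- which is at most p_y, is at least doubled.  The numbers of steps t and of slides
-- are roots of quadratic equations, hence cost O(1).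

open import Defs
open import Data.Bool using (Bool; true; false; T; if_then_else_)
open import Data.Unit using (tt)
open import Data.Empty using (⊥; ⊥-elim)
open import Data.Nat as ℕ using (ℕ; zero; suc; z≤n; s≤s)
import Data.Nat.Properties as ℕP
import Data.Nat.DivMod as ℕD
open import Data.Nat.Logarithm using (⌊log₂_⌋; ⌊log₂⌋-mono-≤; ⌊log₂[2^n]⌋≡n)
import Data.Nat.Tactic.RingSolver as ℕ-Solver
open import Data.Integer as ℤ using (ℤ; +_; -[1+_])
import Data.Integer.Properties as ℤP
import Data.Integer.DivMod as ℤD
open import Data.Rational using (ℚ; 0ℚ; 1ℚ; mkℚ; _<_; _≤_; _+_; _*_; _-_; -_; _≤ᵇ_; floor; ceiling; ↥_; ↧_; toℚᵘ; positive; nonNegative; ≢-nonZero; >-nonZero; 1/_; _÷_)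
open import Data.Rational.Properties
import Data.Rational.Unnormalised as U
import Data.Rational.Unnormalised.Properties as UP
open import Data.Product using (Σ; ∃-syntax; _×_; _,_; proj₁; proj₂)
open import Data.Sum using (_⊎_; inj₁; inj₂; [_,_]′)
open import Data.Maybe using (Maybe; just; nothing)
open import Data.List using ([]; _∷_)
open import Data.Vec using (Vec) renaming ([] to []ᵛ; _∷_ to _∷ᵛ_)
open import Function using (id)
open import Relation.Nullary using (¬_; yes; no; contradiction)
open import Relation.Nullary.Decidable.Core using (dec⇒maybe)
open import Relation.Binary.PropositionalEquality
open import Tactic.RingSolver using (solve; solve-∀)
open import Tactic.RingSolver.Core.AlmostCommutativeRing using (AlmostCommutativeRing; fromCommutativeRing)

-- The start is u = -b₂ and v the lowest lattice vector with x-coordinate (b₁)ₓ that keeps p + v in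
-- H_n; if p + u itself lies in H_n, the answer is vertical. The coordinate p_y is not bounded in
-- terms of n and det Λ, so the logarithmic bound rests on this choice of v. For a reduced lattice
-- (b₁)ₓ ≥ 1, and p + v - b₂ lies outside H_n, whence p_y + v_y < n + (b₂)_y. Thus p_y itself is
-- small when v_y ≥ 0, and otherwise p_y exceeds |v_y| by less than n + (b₂)_y, which leaves few
-- doublings. The halving of |u_y| stops because y-coordinates are multiples of a fixed g > 0, with
-- g = 1 for reduced lattices. Roots of quadratics are available only through ⌊√x⌋. After scaling,
-- the error in t is below one half, so each search yields a candidate that is off by at most one,
-- and testing it and, where needed, its successor settles the matter.

ℚ-ring : AlmostCommutativeRing _ _
ℚ-ring = fromCommutativeRing +-*-commutativeRing λ x → dec⇒maybe (0ℚ ≟ x)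

-- Inequalities from explicit nonnegative expressions

infixl 6 _⊞_ _⊞<_ _<⊞_
infixl 7 _⊠_ _⊠<_

_⊞_ : ∀ {a b} → 0ℚ ≤ a → 0ℚ ≤ b → 0ℚ ≤ a + b
p ⊞ q = +-mono-≤ p q

_⊞<_ : ∀ {a b} → 0ℚ ≤ a → 0ℚ < b → 0ℚ < a + b
p ⊞< q = +-mono-≤-< p q

_<⊞_ : ∀ {a b} → 0ℚ < a → 0ℚ ≤ b → 0ℚ < a + b
p <⊞ q = +-mono-<-≤ p q

_⊠_ : ∀ {a b} → 0ℚ ≤ a → 0ℚ ≤ b → 0ℚ ≤ a * b
_⊠_ {a} {b} p q = subst (_≤ a * b) (*-zeroʳ a) (*-monoˡ-≤-nonNeg a {{nonNegative p}} q)

_⊠<_ : ∀ {a b} → 0ℚ < a → 0ℚ < b → 0ℚ < a * b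
_⊠<_ {a} {b} p q = subst (_< a * b) (*-zeroʳ a) (*-monoʳ-<-pos a {{positive p}} q)

gap : ∀ {a b} → a ≤ b → 0ℚ ≤ b - a
gap {a} {b} p = subst (_≤ b - a) (+-inverseʳ a) (+-monoˡ-≤ (- a) p)

gap< : ∀ {a b} → a < b → 0ℚ < b - a
gap< {a} {b} p = subst (_< b - a) (+-inverseʳ a) (+-monoˡ-< (- a) p)

ungap : ∀ a b → 0ℚ ≤ b - a → a ≤ b
ungap a b p = subst₂ _≤_ (+-identityˡ a) (back a b) (+-monoˡ-≤ a p)
  where
  back : ∀ a b → b - a + a ≡ b
  back = solve-∀ ℚ-ring

ungap< : ∀ a b → 0ℚ < b - a → a < b
ungap< a b p = subst₂ _<_ (+-identityˡ a) (back a b) (+-monoˡ-< a p)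
  where
  back : ∀ a b → b - a + a ≡ b
  back = solve-∀ ℚ-ring

-- The pattern of most inequalities below: `e` is assembled from nonnegative pieces with `⊞` and
-- `⊠`, and the ring solver identifies it with `b - a`.
cert : ∀ {a b e} → 0ℚ ≤ e → e ≡ b - a → a ≤ b
cert {a} {b} p e = ungap a b (subst (0ℚ ≤_) e p)

cert< : ∀ {a b e} → 0ℚ < e → e ≡ b - a → a < b
cert< {a} {b} p e = ungap< a b (subst (0ℚ <_) e p)

0≤1 : 0ℚ ≤ 1ℚ
0≤1 = ≤ᵇ⇒≤ tt

0<1 : 0ℚ < 1ℚ
0<1 = positive⁻¹ 1ℚ

<⇒≱ : ∀ {a b} → a < b → ¬ (b ≤ a)
<⇒≱ p q = <-irrefl refl (<-≤-trans p q)

sq≥0 : ∀ a → 0ℚ ≤ a * a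
sq≥0 a with ≤-total 0ℚ a
... | inj₁ p = p ⊠ p
... | inj₂ p = cert (gap p ⊠ gap p) (solve (a ∷ []) ℚ-ring)

pos-cancelˡ : ∀ c {b} → 0ℚ < c → 0ℚ < c * b → 0ℚ < b
pos-cancelˡ c {b} p q = *-cancelˡ-<-nonNeg c {{nonNegative (<⇒≤ p)}} (subst (_< c * b) (sym (*-zeroʳ c)) q)

nonneg-cancelˡ : ∀ c {b} → 0ℚ < c → 0ℚ ≤ c * b → 0ℚ ≤ b
nonneg-cancelˡ c {b} p q = *-cancelˡ-≤-pos c {{positive p}} (subst (_≤ c * b) (sym (*-zeroʳ c)) q)

*-cancelˡ-≤′ : ∀ c a b → 0ℚ < c → c * a ≤ c * b → a ≤ b
*-cancelˡ-≤′ c a b p q = *-cancelˡ-≤-pos c {{positive p}} q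

*-cancelˡ-<′ : ∀ c a b → 0ℚ < c → c * a < c * b → a < b
*-cancelˡ-<′ c a b p q = *-cancelˡ-<-nonNeg c {{nonNegative (<⇒≤ p)}} q

sq-cancel-< : ∀ a b → 0ℚ ≤ b → a * a < b * b → a < b
sq-cancel-< a b 0≤b a²<b² with a <? b
... | yes a<b = a<b
... | no a≮b = ⊥-elim (<⇒≱ a²<b² (cert (gap b≤a ⊠ (0≤b ⊞ ≤-trans 0≤b b≤a)) (solve (a ∷ b ∷ []) ℚ-ring)))
  where b≤a = ≮⇒≥ a≮b

sq-cancel-≤ : ∀ a b → 0ℚ ≤ b → a * a ≤ b * b → a ≤ b
sq-cancel-≤ a b 0≤b a²≤b² with a ≤? b
... | yes a≤b = a≤b
... | no a≰b = ⊥-elim (<⇒≱ b²<a² a²≤b²)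
  where
  b<a : b < a
  b<a = ≰⇒> a≰b
  b²<a² : b * b < a * a
  b²<a² = cert< (gap< b<a ⊠< (0≤b ⊞< ≤-<-trans 0≤b b<a)) (solve (a ∷ b ∷ []) ℚ-ring)

sq-mono-≤ : ∀ a b → - b ≤ a → a ≤ b → a * a ≤ b * b
sq-mono-≤ a b p q = cert (gap p ⊠ gap q) (solve (a ∷ b ∷ []) ℚ-ring)

-- The embedding of the integers

toℚᵘ-zℚ : ∀ z → toℚᵘ (zℚ z) U.≃ U.mkℚᵘ z 0
toℚᵘ-zℚ z = toℚᵘ-fromℚᵘ (U.mkℚᵘ z 0)

zℚ-+ : ∀ a b → zℚ (a ℤ.+ b) ≡ zℚ a + zℚ b
zℚ-+ a b = toℚᵘ-injective (UP.≃-trans (toℚᵘ-zℚ (a ℤ.+ b)) (UP.≃-sym (UP.≃-trans (toℚᵘ-homo-+ (zℚ a) (zℚ b)) (UP.≃-trans (UP.+-cong (toℚᵘ-zℚ a) (toℚᵘ-zℚ b)) (U.*≡* (cong (ℤ._* + 1) (cong₂ ℤ._+_ (ℤP.*-identityʳ a) (ℤP.*-identityʳ b))))))))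

zℚ-* : ∀ a b → zℚ (a ℤ.* b) ≡ zℚ a * zℚ b
zℚ-* a b = toℚᵘ-injective (UP.≃-trans (toℚᵘ-zℚ (a ℤ.* b)) (UP.≃-sym (UP.≃-trans (toℚᵘ-homo-* (zℚ a) (zℚ b)) (UP.≃-trans (UP.*-cong (toℚᵘ-zℚ a) (toℚᵘ-zℚ b)) (U.*≡* refl)))))

zℚ-neg : ∀ a → zℚ (ℤ.- a) ≡ - zℚ a
zℚ-neg a = toℚᵘ-injective (UP.≃-trans (toℚᵘ-zℚ (ℤ.- a)) (UP.≃-sym (UP.≃-trans (toℚᵘ-homo‿- (zℚ a)) (UP.-‿cong (toℚᵘ-zℚ a)))))

zℚ-mono-≤ : ∀ {a b} → a ℤ.≤ b → zℚ a ≤ zℚ b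
zℚ-mono-≤ {a} {b} p = toℚᵘ-cancel-≤ (UP.≤-respˡ-≃ (UP.≃-sym (toℚᵘ-zℚ a)) (UP.≤-respʳ-≃ (UP.≃-sym (toℚᵘ-zℚ b)) (U.*≤* (ℤP.*-monoʳ-≤-nonNeg (+ 1) p))))

zℚ-mono-< : ∀ {a b} → a ℤ.< b → zℚ a < zℚ b
zℚ-mono-< {a} {b} p = toℚᵘ-cancel-< (UP.<-respˡ-≃ (UP.≃-sym (toℚᵘ-zℚ a)) (UP.<-respʳ-≃ (UP.≃-sym (toℚᵘ-zℚ b)) (U.*<* (ℤP.*-monoʳ-<-pos (+ 1) p))))

zℚ-cancel-≤ : ∀ a b → zℚ a ≤ zℚ b → a ℤ.≤ b
zℚ-cancel-≤ a b p = ℤP.≮⇒≥ λ b<a → <⇒≱ (zℚ-mono-< b<a) p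

zℚ-cancel-< : ∀ a b → zℚ a < zℚ b → a ℤ.< b
zℚ-cancel-< a b p = ℤP.≰⇒> λ b≤a → <⇒≱ p (zℚ-mono-≤ b≤a)

zℚ-injective : ∀ {a b} → zℚ a ≡ zℚ b → a ≡ b
zℚ-injective {a} {b} e = ℤP.≤-antisym (zℚ-cancel-≤ a b (≤-reflexive e)) (zℚ-cancel-≤ b a (≤-reflexive (sym e)))

integral-+ : ∀ {a b} → IsIntegral a → IsIntegral b → IsIntegral (a + b)
integral-+ (x , refl) (y , refl) = x ℤ.+ y , sym (zℚ-+ x y)

integral-* : ∀ {a b} → IsIntegral a → IsIntegral b → IsIntegral (a * b)
integral-* (x , refl) (y , refl) = x ℤ.* y , sym (zℚ-* x y)

integral-neg : ∀ {a} → IsIntegral a → IsIntegral (- a)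
integral-neg (x , refl) = ℤ.- x , sym (zℚ-neg x)

integral-sub : ∀ {a b} → IsIntegral a → IsIntegral b → IsIntegral (a - b)
integral-sub p q = integral-+ p (integral-neg q)

integral-0 : IsIntegral 0ℚ
integral-0 = + 0 , refl

integral-1 : IsIntegral 1ℚ
integral-1 = + 1 , refl

integral-<⇒+1≤ : ∀ {a b} → IsIntegral a → IsIntegral b → a < b → a + 1ℚ ≤ b
integral-<⇒+1≤ (x , refl) (y , refl) p = subst (_≤ zℚ y) (trans (cong zℚ (ℤP.+-comm (+ 1) x)) (zℚ-+ x (+ 1))) (zℚ-mono-≤ (ℤP.i<j⇒suc[i]≤j (zℚ-cancel-< x y p)))

↧-positive : ∀ q → 0ℚ < zℚ (↧ q)
↧-positive (mkℚ _ d _) = zℚ-mono-< {+ 0} {+ suc d} (ℤ.+<+ (s≤s z≤n))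

*-↧≡↥ : ∀ q → q * zℚ (↧ q) ≡ zℚ (↥ q)
*-↧≡↥ q@(mkℚ n d _) = toℚᵘ-injective (UP.≃-trans (toℚᵘ-homo-* q (zℚ (+ suc d))) (UP.≃-trans (UP.*-congˡ {U.mkℚᵘ n d} (toℚᵘ-zℚ (+ suc d))) (UP.≃-trans (U.*≡* lem) (UP.≃-sym (toℚᵘ-zℚ n)))))
  where
  lem : n ℤ.* + suc d ℤ.* + 1 ≡ n ℤ.* + (suc d ℕ.* 1)
  lem = trans (ℤP.*-identityʳ _) (cong (λ k → n ℤ.* + k) (sym (ℕP.*-identityʳ (suc d))))

-- Rounding

floor-≤ : ∀ q → zℚ (floor q) ≤ q
floor-≤ q@(mkℚ n d _) = *-cancelʳ-≤-pos (zℚ (↧ q)) {{positive (↧-positive q)}} (subst₂ _≤_ (zℚ-* (floor q) (↧ q)) (sym (*-↧≡↥ q)) (zℚ-mono-≤ (ℤD.[n/d]*d≤n n (+ suc d))))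

<-floor+1 : ∀ q → q < zℚ (floor q) + 1ℚ
<-floor+1 q@(mkℚ n d _) = *-cancelʳ-<-nonNeg (zℚ (↧ q)) {{nonNegative (<⇒≤ (↧-positive q))}} (subst₂ _<_ (sym (*-↧≡↥ q)) eq (zℚ-mono-< bound))
  where
  bound : n ℤ.< ℤ.suc (floor q) ℤ.* + suc d
  bound = subst (λ k → n ℤ.< ℤ.suc k ℤ.* + suc d) (sym (ℤP.*-identityˡ (n ℤD./ℕ suc d))) (ℤD.n<s[n/ℕd]*d n (suc d))
  eq : zℚ (ℤ.suc (floor q) ℤ.* + suc d) ≡ (zℚ (floor q) + 1ℚ) * zℚ (↧ q)
  eq = trans (zℚ-* (ℤ.suc (floor q)) (+ suc d)) (cong (_* zℚ (↧ q)) (trans (cong zℚ (ℤP.+-comm (+ 1) (floor q))) (zℚ-+ (floor q) (+ 1))))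

≤-ceiling : ∀ q → q ≤ zℚ (ceiling q)
≤-ceiling q@(mkℚ _ _ _) = subst (q ≤_) (sym (zℚ-neg (floor (- q)))) (neg-swap q (zℚ (floor (- q))) (floor-≤ (- q)))
  where
  neg-swap : ∀ x f → f ≤ - x → x ≤ - f
  neg-swap x f p = cert (gap p) (solve (x ∷ f ∷ []) ℚ-ring)

record IsFloorDiv (x y f : ℚ) : Set where
  field
    lower : f * y ≤ x
    upper : x < (f + 1ℚ) * y

fdivℚ-integral : ∀ x y → IsIntegral (fdivℚ x y)
fdivℚ-integral x y with y ≟ 0ℚ
... | yes _ = + 0 , refl
... | no y≢0 = floor (_÷_ x y {{≢-nonZero y≢0}}) , refl

fdivℚ-floor : ∀ x y → 0ℚ < y → IsFloorDiv x y (fdivℚ x y)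
fdivℚ-floor x y 0<y with y ≟ 0ℚ
... | yes y≡0 = contradiction (sym y≡0) (<⇒≢ 0<y)
... | no y≢0 = record
  { lower = subst (zℚ (floor q) * y ≤_) back (*-monoʳ-≤-nonNeg y {{nonNegative (<⇒≤ 0<y)}} (floor-≤ q))
  ; upper = subst (_< (zℚ (floor q) + 1ℚ) * y) back (*-monoˡ-<-pos y {{positive 0<y}} (<-floor+1 q)) }
  where
  instance
    _ = ≢-nonZero y≢0
  q = x ÷ y
  back : q * y ≡ x
  back = trans (*-assoc x (1/ y) y) (trans (cong (x *_) (*-inverseˡ y)) (*-identityʳ x))

mutual
  -- The search loop local to isqrtℕ cannot be named; unification recovers it.
  isqrt-search : ℕ → ℕ → ℕ
  isqrt-search = _

  isqrt-search-unfold : ∀ m → isqrtℕ (suc m) ≡ (if (suc m ℕ.* suc m) ℕ.≤ᵇ suc m then suc m else isqrt-search (suc m) m)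
  isqrt-search-unfold m with suc m
  ... | w = refl

isqrt-search-spec : ∀ n r → n ℕ.< suc r ℕ.* suc r →
  isqrt-search n r ℕ.* isqrt-search n r ℕ.≤ n × n ℕ.< suc (isqrt-search n r) ℕ.* suc (isqrt-search n r)
isqrt-search-spec n zero h = z≤n , h
isqrt-search-spec n (suc r) h with (suc r ℕ.* suc r) ℕ.≤ᵇ n in eq
... | true = ℕP.≤ᵇ⇒≤ (suc r ℕ.* suc r) n (subst T (sym eq) tt) , h
... | false = isqrt-search-spec n r (ℕP.≰⇒> λ le → subst T eq (ℕP.≤⇒≤ᵇ le))

isqrtℕ-spec : ∀ n → isqrtℕ n ℕ.* isqrtℕ n ℕ.≤ n × n ℕ.< suc (isqrtℕ n) ℕ.* suc (isqrtℕ n)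
isqrtℕ-spec n = isqrt-search-spec n n (s≤s (ℕP.≤-trans (ℕP.m≤m*n n (suc n)) (ℕP.m≤n+m (n ℕ.* suc n) n)))

zℕ-* : ∀ m n → zℚ (+ (m ℕ.* n)) ≡ zℚ (+ m) * zℚ (+ n)
zℕ-* m n = trans (cong zℚ (ℤP.pos-* m n)) (zℚ-* (+ m) (+ n))

zℕ-suc : ∀ m → zℚ (+ suc m) ≡ zℚ (+ m) + 1ℚ
zℕ-suc m = trans (cong (λ k → zℚ (+ k)) (ℕP.+-comm 1 m)) (zℚ-+ (+ m) (+ 1))

zℕ-nonneg : ∀ m → 0ℚ ≤ zℚ (+ m)
zℕ-nonneg m = zℚ-mono-≤ {+ 0} {+ m} (ℤ.+≤+ z≤n)

-- `lower` is conditional because the root of a negative number is 0 in the model.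
record IsFloorSqrt (x s : ℚ) : Set where
  field
    nonneg   : 0ℚ ≤ s
    lower    : 0ℚ ≤ x → s * s ≤ x
    upper    : x < (s + 1ℚ) * (s + 1ℚ)

-- For x = a/b let r = ⌊√(a b)⌋ and s = ⌊r/b⌋. Then s b ≤ r gives (s b)² ≤ a b, and r + 1 ≤ (s + 1)
-- b gives a b < ((s + 1) b)². Cancelling b leaves s² b ≤ a < (s + 1)² b, so nesting the floors
-- loses nothing.
isqrtℚ-floor : ∀ x → IsFloorSqrt x (isqrtℚ x)
isqrtℚ-floor x@(mkℚ -[1+ a ] d _) = record
  { nonneg = ≤-refl
  ; lower = λ 0≤x → ⊥-elim (<⇒≱ x<0 0≤x)
  ; upper = <-trans x<0 (0<1 ⊠< 0<1) }
  where
  x<0 : x < 0ℚ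
  x<0 = negative⁻¹ x
isqrtℚ-floor x@(mkℚ (+ a) d _) = record
  { nonneg = zℕ-nonneg s
  ; lower = λ _ → *-cancelˡ-≤′ D _ _ D>0 (subst₂ _≤_ (lo-eq D S) (trans (sym (*-↧≡↥ x)) (*-comm x D)) lo)
  ; upper = *-cancelˡ-<′ D _ _ D>0 (subst₂ _<_ (trans (sym (*-↧≡↥ x)) (*-comm x D)) (lo-eq D (S + 1ℚ)) hi) }
  where
  b = suc d
  r = isqrtℕ (a ℕ.* b)
  s = r ℕD./ b
  S = zℚ (+ s)
  D = zℚ (+ b)
  D>0 : 0ℚ < D
  D>0 = ↧-positive x
  lo-eq : ∀ D S → S * (S * D) ≡ D * (S * S)
  lo-eq = solve-∀ ℚ-ring
  sb≤r : s ℕ.* b ℕ.≤ r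
  sb≤r = ℕD.m/n*n≤m r b
  r<sb : r ℕ.< suc s ℕ.* b
  r<sb = ℕP.≤-<-trans (ℕP.≤-reflexive (ℕD.m≡m%n+[m/n]*n r b)) (ℕP.+-monoˡ-< (s ℕ.* b) (ℕD.m%n<n r b))
  swap : ∀ s b → s ℕ.* b ℕ.* (s ℕ.* b) ≡ s ℕ.* (s ℕ.* b) ℕ.* b
  swap s b = trans (cong (ℕ._* (s ℕ.* b)) (ℕP.*-comm s b)) (trans (ℕP.*-assoc b s (s ℕ.* b)) (ℕP.*-comm b (s ℕ.* (s ℕ.* b))))
  ssb≤a : s ℕ.* (s ℕ.* b) ℕ.≤ a
  ssb≤a = ℕP.*-cancelʳ-≤ (s ℕ.* (s ℕ.* b)) a b (ℕP.≤-trans (ℕP.≤-reflexive (sym (swap s b))) (ℕP.≤-trans (ℕP.*-mono-≤ sb≤r sb≤r) (proj₁ (isqrtℕ-spec (a ℕ.* b)))))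
  a<ssb : a ℕ.< suc s ℕ.* (suc s ℕ.* b)
  a<ssb = ℕP.*-cancelʳ-< b a (suc s ℕ.* (suc s ℕ.* b)) (ℕP.<-≤-trans (proj₂ (isqrtℕ-spec (a ℕ.* b))) (ℕP.≤-trans (ℕP.*-mono-≤ r<sb r<sb) (ℕP.≤-reflexive (swap (suc s) b))))
  lo : S * (S * D) ≤ zℚ (+ a)
  lo = subst (_≤ zℚ (+ a)) (trans (zℕ-* s (s ℕ.* b)) (cong (S *_) (zℕ-* s b))) (zℚ-mono-≤ (ℤ.+≤+ ssb≤a))
  hi : zℚ (+ a) < (S + 1ℚ) * ((S + 1ℚ) * D)
  hi = subst (zℚ (+ a) <_) (trans (zℕ-* (suc s) (suc s ℕ.* b)) (trans (cong (zℚ (+ suc s) *_) (zℕ-* (suc s) b)) (cong (λ z → z * (z * D)) (zℕ-suc s)))) (zℚ-mono-< (ℤ.+<+ a<ssb))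

-- Programs and their cost

infixl 1 _>>=_

_>>=_ : ∀ {V R S : Set} → Prog V R → (R → Prog V S) → Prog V S
ret r       >>= f = f r
bin o x y κ >>= f = bin o x y λ z → κ z >>= f
sqrtᵢ x κ   >>= f = sqrtᵢ x λ z → κ z >>= f
lit z κ     >>= f = lit z λ v → κ v >>= f
leq x y κ   >>= f = leq x y λ b → κ b >>= f

-- A Hoare triple with a bound on the cost. Each branch of `leq` receives the outcome of the
-- comparison, so an impossible branch can be refuted.
data Spec {R : Set} (P : R → Set) : Prog ℚ R → ℕ → Set where
  ret   : ∀ {r c} → P r → Spec P (ret r) c
  bin   : ∀ {o x y κ c} → Spec P (κ (evalBin o x y)) c → Spec P (bin o x y κ) (suc c)
  sqrtᵢ : ∀ {x κ c} → Spec P (κ (isqrtℚ x)) c → Spec P (sqrtᵢ x κ) (suc c)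
  lit   : ∀ {z κ c} → Spec P (κ (zℚ z)) c → Spec P (lit z κ) (suc c)
  leq   : ∀ {x y κ c} → (x ≤ y → Spec P (κ true) c) → (y < x → Spec P (κ false) c) → Spec P (leq x y κ) (suc c)

Spec-weaken : ∀ {R} {P : R → Set} {m c d} → c ℕ.≤ d → Spec P m c → Spec P m d
Spec-weaken c≤d (ret p) = ret p
Spec-weaken (s≤s c≤d) (bin s) = bin (Spec-weaken c≤d s)
Spec-weaken (s≤s c≤d) (sqrtᵢ s) = sqrtᵢ (Spec-weaken c≤d s)
Spec-weaken (s≤s c≤d) (lit s) = lit (Spec-weaken c≤d s)
Spec-weaken (s≤s c≤d) (leq s s′) = leq (λ p → Spec-weaken c≤d (s p)) (λ p → Spec-weaken c≤d (s′ p))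

Spec-bind : ∀ {R S} {P : R → Set} {Q : S → Set} {m f c d} → Spec P m c → (∀ r → P r → Spec Q (f r) d) → Spec Q (m >>= f) (c ℕ.+ d)
Spec-bind {c = c} {d} (ret {r} p) k = Spec-weaken (ℕP.m≤n+m d c) (k r p)
Spec-bind (bin s) k = bin (Spec-bind s k)
Spec-bind (sqrtᵢ s) k = sqrtᵢ (Spec-bind s k)
Spec-bind (lit s) k = lit (Spec-bind s k)
Spec-bind (leq s s′) k = leq (λ p → Spec-bind (s p) k) (λ p → Spec-bind (s′ p) k)

exec-sound : ∀ {R} {P : R → Set} {m c} → Spec P m c → P (proj₁ (exec m)) × proj₂ (exec m) ℕ.≤ c
exec-sound (ret p) = p , z≤n
exec-sound (bin s) with p , q ← exec-sound s = p , s≤s q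
exec-sound (sqrtᵢ s) with p , q ← exec-sound s = p , s≤s q
exec-sound (lit s) with p , q ← exec-sound s = p , s≤s q
exec-sound (leq {x} {y} s s′) with x ≤ᵇ y in eq
... | true with p , q ← exec-sound (s (≤ᵇ⇒≤ (subst T (sym eq) tt))) = p , s≤s q
... | false with p , q ← exec-sound (s′ (≰⇒> λ le → subst T eq (≤⇒≤ᵇ le))) = p , s≤s q

-- Lattice points on a line and the hyperbola

2ℚ 4ℚ : ℚ
2ℚ = zℚ (+ 2)
4ℚ = zℚ (+ 4)

integral-nonneg-cases : ∀ {a} → IsIntegral a → 0ℚ ≤ a → a ≡ 0ℚ ⊎ 1ℚ ≤ a
integral-nonneg-cases {a} i 0≤a with 1ℚ ≤? a
... | yes p = inj₂ p
... | no p = inj₁ (≤-antisym a≤0 0≤a)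
  where
  a+1≤1 : a + 1ℚ ≤ 1ℚ
  a+1≤1 = integral-<⇒+1≤ i integral-1 (≰⇒> p)
  a≤0 : a ≤ 0ℚ
  a≤0 = cert (gap a+1≤1) (solve (a ∷ []) ℚ-ring)

-- Only the product is constrained; the signs of the coordinates are recovered separately with
-- `pos-factor`.
Feas : (n A C X Y t : ℚ) → Set
Feas n A C X Y t = n ≤ (X + t * A) * (Y + t * C)

-- With c = |A C|, the solutions t of (X + t A)(Y + t C) = n are
-- (± P ± √R) / Q, where R = M² ((A Y − C X)² + 4 A C n) and the scale M is
-- chosen so that Q ≥ 2, which makes ⌊√R⌋ precise enough.
surd : {V : Set} → (A C X Y n c : V) → Prog V (V × V × V)
surd A C X Y n c =
  lit (+ 1) λ one → lit (+ 2) λ two → lit (+ 4) λ four →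
  bin fdiv one c λ m → bin add m one λ M →
  bin mul A Y λ AY → bin mul C X λ CX →
  bin add AY CX λ B → bin sub AY CX λ E →
  bin mul E E λ E² → bin mul A C λ AC → bin mul AC n λ ACn →
  bin mul four ACn λ F → bin add E² F λ Δ →
  bin mul M M λ M² → bin mul M² Δ λ R → sqrtᵢ R λ S →
  bin mul M B λ P → bin mul two c λ c₂ → bin mul c₂ M λ Q →
  ret (P , S , Q)

record IsSurd (A C X Y n c P S Q : ℚ) : Set where
  field
    M     : ℚ
    M-pos : 0ℚ < M
    P-eq  : P ≡ M * (A * Y + C * X)
    Q-eq  : Q ≡ 2ℚ * c * M
    2≤Q   : 2ℚ ≤ Q
  R : ℚ
  R = M * M * ((A * Y - C * X) * (A * Y - C * X) + 4ℚ * (A * C * n))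
  field
    √R    : IsFloorSqrt R S

  open IsFloorSqrt √R public

  Q>0 : 0ℚ < Q
  Q>0 = <-≤-trans (positive⁻¹ 2ℚ) 2≤Q

surd-spec : ∀ A C X Y n c → 0ℚ < c → Spec (λ (P , S , Q) → IsSurd A C X Y n c P S Q) (surd A C X Y n c) 20
surd-spec A C X Y n c 0<c = lit (lit (lit (bin (bin (bin (bin (bin (bin (bin (bin (bin (bin (bin (bin (bin (sqrtᵢ (bin (bin (bin (ret record
  { M = M ; M-pos = M>0 ; P-eq = refl ; Q-eq = refl ; 2≤Q = scale c M 1<Mc ; √R = isqrtℚ-floor _ }))))))))))))))))))))
  where
  M = fdivℚ 1ℚ c + 1ℚ
  1<Mc : 1ℚ < M * c
  1<Mc = IsFloorDiv.upper (fdivℚ-floor 1ℚ c 0<c)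
  M>0 : 0ℚ < M
  M>0 = pos-cancelˡ c 0<c (subst (0ℚ <_) (*-comm M c) (<-trans 0<1 1<Mc))
  scale : ∀ c M → 1ℚ < M * c → 2ℚ ≤ 2ℚ * c * M
  scale c M h = cert (<⇒≤ (gap< h) ⊞ <⇒≤ (gap< h)) (solve (c ∷ M ∷ []) ℚ-ring)

module Concave {A C X Y n P S Q} (su : IsSurd A C X Y n (0ℚ - A * C) P S Q) (0<c : 0ℚ < 0ℚ - A * C) where
  open IsSurd su

  K : ℚ
  K = 4ℚ * (0ℚ - A * C) * (M * M)

  K>0 : 0ℚ < K
  K>0 = (positive⁻¹ 4ℚ ⊠< 0<c) ⊠< (M-pos ⊠< M-pos)

  -- Completing the square: since `K` is positive, t is feasible exactly when (Q t - P)² ≤ R. With S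
  -- ≤ √R < S + 1, |Q t - P| < S + 1 is necessary and |Q t - P| ≤ S is sufficient.
  value : ∀ t → (Q * t - P) * (Q * t - P) + K * ((X + t * A) * (Y + t * C) - n) ≡ R
  value t rewrite P-eq | Q-eq = identity A C X Y n M t
    where
    identity : ∀ A C X Y n M t → (2ℚ * (0ℚ - A * C) * M * t - M * (A * Y + C * X)) * (2ℚ * (0ℚ - A * C) * M * t - M * (A * Y + C * X)) + 4ℚ * (0ℚ - A * C) * (M * M) * ((X + t * A) * (Y + t * C) - n) ≡ M * M * ((A * Y - C * X) * (A * Y - C * X) + 4ℚ * (A * C * n))
    identity = solve-∀ ℚ-ring

  sq≤R : ∀ {t} → Feas n A C X Y t → (Q * t - P) * (Q * t - P) ≤ R
  sq≤R {t} f = subst ((Q * t - P) * (Q * t - P) ≤_) (value t) (grow _ _ (<⇒≤ K>0 ⊠ gap f))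
    where
    grow : ∀ a b → 0ℚ ≤ b → a ≤ a + b
    grow a b p = cert p (solve (a ∷ b ∷ []) ℚ-ring)

  R≥0 : ∀ {t} → Feas n A C X Y t → 0ℚ ≤ R
  R≥0 {t} f = ≤-trans (sq≥0 (Q * t - P)) (sq≤R f)

  upper-bound : ∀ {t} → Feas n A C X Y t → Q * t - P < S + 1ℚ
  upper-bound {t} f = sq-cancel-< (Q * t - P) (S + 1ℚ) (nonneg ⊞ 0≤1) (≤-<-trans (sq≤R f) upper)

  lower-bound : ∀ {t} → Feas n A C X Y t → P - Q * t < S + 1ℚ
  lower-bound {t} f = sq-cancel-< (P - Q * t) (S + 1ℚ) (nonneg ⊞ 0≤1) (subst (_< (S + 1ℚ) * (S + 1ℚ)) (flip (Q * t) P) (≤-<-trans (sq≤R f) upper))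
    where
    flip : ∀ a b → (a - b) * (a - b) ≡ (b - a) * (b - a)
    flip = solve-∀ ℚ-ring

  between : ∀ {t} → 0ℚ ≤ R → P - Q * t ≤ S → Q * t - P ≤ S → Feas n A C X Y t
  between {t} 0≤R lo hi = ungap _ _ (nonneg-cancelˡ K K>0 (remainder _ _ R (value t) (≤-trans (sq-mono-≤ (Q * t - P) S (flip (Q * t) P S lo) hi) (lower 0≤R))))
    where
    flip : ∀ a b s → b - a ≤ s → - s ≤ a - b
    flip a b s p = cert (gap p) (solve (a ∷ b ∷ s ∷ []) ℚ-ring)
    remainder : ∀ a b r → a + b ≡ r → a ≤ r → 0ℚ ≤ b
    remainder a b r refl p = cert (gap p) (solve (a ∷ b ∷ []) ℚ-ring)

module Convex {A C X Y n P S Q} (su : IsSurd A C X Y n (A * C) P S Q) (0<c : 0ℚ < A * C) where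
  open IsSurd su

  K : ℚ
  K = 4ℚ * (A * C) * (M * M)

  K>0 : 0ℚ < K
  K>0 = (positive⁻¹ 4ℚ ⊠< 0<c) ⊠< (M-pos ⊠< M-pos)

  -- Here feasibility means (Q t + P)² ≥ R, so t lies outside the two roots. The sign conditions in
  -- `lower-bound` select the branch with Q t + P ≥ 0.
  value : ∀ t → (Q * t + P) * (Q * t + P) ≡ R + K * ((X + t * A) * (Y + t * C) - n)
  value t rewrite P-eq | Q-eq = identity A C X Y n M t
    where
    identity : ∀ A C X Y n M t → (2ℚ * (A * C) * M * t + M * (A * Y + C * X)) * (2ℚ * (A * C) * M * t + M * (A * Y + C * X)) ≡ M * M * ((A * Y - C * X) * (A * Y - C * X) + 4ℚ * (A * C * n)) + 4ℚ * (A * C) * (M * M) * ((X + t * A) * (Y + t * C) - n)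
    identity = solve-∀ ℚ-ring

  R≥0 : 0ℚ ≤ n → 0ℚ ≤ R
  R≥0 0≤n = (<⇒≤ M-pos ⊠ <⇒≤ M-pos) ⊠ (sq≥0 (A * Y - C * X) ⊞ (nonNegative⁻¹ 4ℚ ⊠ (<⇒≤ 0<c ⊠ 0≤n)))

  lower-bound : ∀ {t} → 0ℚ ≤ n → 0ℚ ≤ A → 0ℚ ≤ C → 0ℚ ≤ X + t * A → 0ℚ ≤ Y + t * C → Feas n A C X Y t → S ≤ Q * t + P
  lower-bound {t} 0≤n 0≤A 0≤C 0≤x 0≤y f = sq-cancel-≤ S (Q * t + P) sum≥0 (≤-trans (lower (R≥0 0≤n)) R≤sq)
    where
    R≤sq : R ≤ (Q * t + P) * (Q * t + P)
    R≤sq = subst (R ≤_) (sym (value t)) (grow R _ (<⇒≤ K>0 ⊠ gap f))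
      where
      grow : ∀ a b → 0ℚ ≤ b → a ≤ a + b
      grow a b p = cert p (solve (a ∷ b ∷ []) ℚ-ring)
    sum≥0 : 0ℚ ≤ Q * t + P
    sum≥0 rewrite P-eq | Q-eq = cert (<⇒≤ M-pos ⊠ ((0≤A ⊠ 0≤y) ⊞ (0≤C ⊠ 0≤x))) (identity A C X Y M t)
      where
      identity : ∀ A C X Y M t → M * (A * (Y + t * C) + C * (X + t * A)) ≡ 2ℚ * (A * C) * M * t + M * (A * Y + C * X) - 0ℚ
      identity = solve-∀ ℚ-ring

  above : ∀ {t} → S + 1ℚ ≤ Q * t + P → Feas n A C X Y t
  above {t} h = ungap _ _ (nonneg-cancelˡ K K>0 (remainder _ _ _ (value t) (≤-trans (<⇒≤ upper) (sq-mono-≤ (S + 1ℚ) (Q * t + P) (flip _ _ (nonneg ⊞ 0≤1) h) h))))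
    where
    flip : ∀ a b → 0ℚ ≤ a → a ≤ b → - b ≤ a
    flip a b 0≤a a≤b = cert (0≤a ⊞ (0≤a ⊞ gap a≤b)) (solve (a ∷ b ∷ []) ℚ-ring)
    remainder : ∀ s r b → s ≡ r + b → r ≤ s → 0ℚ ≤ b
    remainder s r b refl p = cert (gap p) (solve (r ∷ b ∷ []) ℚ-ring)

inside : {V : Set} → (n A C X Y t : V) → Prog V Bool
inside n A C X Y t =
  bin mul t A λ tA → bin add X tA λ x → bin mul t C λ tC → bin add Y tC λ y →
  bin mul x y λ xy → leq n xy ret

inside-spec : ∀ n A C X Y t → Spec (λ b → if b then Feas n A C X Y t else ¬ Feas n A C X Y t) (inside n A C X Y t) 6
inside-spec n A C X Y t = bin (bin (bin (bin (bin (leq (λ p → ret p) (λ p → ret (<⇒≱ p)))))))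

-- `G` is never too small, because `S + 1` exceeds √R, and at most one too large, because `Q` is at
-- least 2. One test of `G` decides.
last : {V : Set} → (n A C X Y : V) → Prog V V
last n A C X Y =
  lit (+ 0) λ nil → lit (+ 1) λ one → bin mul A C λ AC → bin sub nil AC λ c →
  surd A C X Y n c >>= λ (P , S , Q) →
  bin add P S λ a → bin add a one λ b → bin fdiv b Q λ G →
  inside n A C X Y G >>= λ b → if b then ret G else bin sub G one ret

record IsLast (n A C X Y s : ℚ) : Set where
  field
    integral : IsIntegral s
    nonneg   : 0ℚ ≤ s
    feasible : Feas n A C X Y s
    maximal  : ∀ {t} → IsIntegral t → Feas n A C X Y t → t ≤ s

concave-coefficient : ∀ A C → 0ℚ < A → C < 0ℚ → 0ℚ < 0ℚ - A * C
concave-coefficient A C 0<A C<0 = cert< (0<A ⊠< gap< C<0) (solve (A ∷ C ∷ []) ℚ-ring)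

≤-pred-integral : ∀ {a b} → IsIntegral a → IsIntegral b → a < b + 1ℚ → a ≤ b
≤-pred-integral {a} {b} i j p = cert (gap (integral-<⇒+1≤ i (integral-+ j integral-1) p)) (solve (a ∷ b ∷ []) ℚ-ring)

Feas-0 : ∀ n A C X Y → n ≤ X * Y → Feas n A C X Y 0ℚ
Feas-0 n A C X Y p = subst (n ≤_) (identity A C X Y) p
  where
  identity : ∀ A C X Y → X * Y ≡ (X + 0ℚ * A) * (Y + 0ℚ * C)
  identity = solve-∀ ℚ-ring

module LastCandidate {n A C X Y P S Q : ℚ} (su : IsSurd A C X Y n (0ℚ - A * C) P S Q) (0<c : 0ℚ < 0ℚ - A * C)
  (start : n ≤ X * Y) (G : ℚ) (G-int : IsIntegral G) (G-floor : IsFloorDiv (P + S + 1ℚ) Q G) where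
  open Concave su 0<c
  open IsSurd su using (2≤Q; Q>0)
  open IsFloorDiv G-floor

  start-feasible : Feas n A C X Y 0ℚ
  start-feasible = Feas-0 n A C X Y start

  ≤G : ∀ {t} → IsIntegral t → Feas n A C X Y t → t ≤ G
  ≤G {t} i f = ≤-pred-integral i G-int (*-cancelˡ-<′ Q t (G + 1ℚ) Q>0 (shift P S Q G t (upper-bound {t} f) upper))
    where
    shift : ∀ P S Q G t → Q * t - P < S + 1ℚ → P + S + 1ℚ < (G + 1ℚ) * Q → Q * t < Q * (G + 1ℚ)
    shift P S Q G t p q = cert< (<⇒≤ (gap< p) ⊞< gap< q) (solve (P ∷ S ∷ Q ∷ G ∷ t ∷ []) ℚ-ring)

  0≤G : 0ℚ ≤ G
  0≤G = ≤G {0ℚ} integral-0 start-feasible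

  module _ (G-out : ¬ Feas n A C X Y G) where
    1≤G : 1ℚ ≤ G
    1≤G = [ (λ G≡0 → ⊥-elim (G-out (subst (Feas n A C X Y) (sym G≡0) start-feasible))) , id ]′ (integral-nonneg-cases G-int 0≤G)

    -- Stepping back from `G` lowers Q t by at least 2, which brings it under P + S. If G - 1 ≥ 1,
    -- it is also far enough above the lower root, since t = 0 is not below that root; if G - 1 = 0,
    -- it is the start itself.
    G-1-feasible : Feas n A C X Y (G - 1ℚ)
    G-1-feasible = [ (λ eq → subst (Feas n A C X Y) (sym eq) start-feasible)
      , (λ 1≤ → between {G - 1ℚ} (R≥0 {0ℚ} start-feasible) (lo P S Q G 2≤Q 1≤ (lower-bound {0ℚ} start-feasible)) (hi P S Q G 2≤Q lower)) ]′
      (integral-nonneg-cases (integral-sub G-int integral-1) (gap 1≤G))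
      where
      lo : ∀ P S Q G → 2ℚ ≤ Q → 1ℚ ≤ G - 1ℚ → P - Q * 0ℚ < S + 1ℚ → P - Q * (G - 1ℚ) ≤ S
      lo P S Q G 2≤Q p q = cert (((≤-trans (nonNegative⁻¹ 2ℚ) 2≤Q ⊠ gap p) ⊞ gap 2≤Q) ⊞ (<⇒≤ (gap< q) ⊞ 0≤1)) (solve (P ∷ S ∷ Q ∷ G ∷ []) ℚ-ring)
      hi : ∀ P S Q G → 2ℚ ≤ Q → G * Q ≤ P + S + 1ℚ → Q * (G - 1ℚ) - P ≤ S
      hi P S Q G 2≤Q p = cert (gap p ⊞ (gap 2≤Q ⊞ 0≤1)) (solve (P ∷ S ∷ Q ∷ G ∷ []) ℚ-ring)

    ≤G-1 : ∀ {t} → IsIntegral t → Feas n A C X Y t → t ≤ G - 1ℚ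
    ≤G-1 {t} i f with t <? G
    ... | yes t<G = step t G (integral-<⇒+1≤ i G-int t<G)
      where
      step : ∀ t G → t + 1ℚ ≤ G → t ≤ G - 1ℚ
      step t G p = cert (gap p) (solve (t ∷ G ∷ []) ℚ-ring)
    ... | no t≮G = ⊥-elim (G-out (subst (Feas n A C X Y) (≤-antisym (≤G i f) (≮⇒≥ t≮G)) f))

  result : Spec (IsLast n A C X Y) (inside n A C X Y G >>= λ b → if b then ret G else bin sub G (zℚ (+ 1)) ret) 7
  result = Spec-bind (inside-spec n A C X Y G) λ
    { true f → ret record { integral = G-int ; nonneg = 0≤G ; feasible = f ; maximal = ≤G }
    ; false ¬f → bin (ret record { integral = integral-sub G-int integral-1 ; nonneg = gap (1≤G ¬f) ; feasible = G-1-feasible ¬f ; maximal = ≤G-1 ¬f }) }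

last-spec : ∀ n A C X Y → 0ℚ < A → C < 0ℚ → n ≤ X * Y → Spec (IsLast n A C X Y) (last n A C X Y) 34
last-spec n A C X Y 0<A C<0 start = lit (lit (bin (bin (Spec-bind (surd-spec A C X Y n _ 0<c) λ (P , S , Q) su →
  bin (bin (bin (LastCandidate.result su 0<c start _ (fdivℚ-integral (P + S + 1ℚ) Q) (fdivℚ-floor (P + S + 1ℚ) Q (IsSurd.Q>0 su)))))))))
  where
  0<c = concave-coefficient A C 0<A C<0

-- A candidate g for the least feasible integer that is too small by at most one.
record IsGuess (n A C X Y g : ℚ) : Set where
  field
    integral    : IsIntegral g
    lower-bound : ∀ {t} → IsIntegral t → 0ℚ < X + t * A → Feas n A C X Y t → g ≤ t
    filled      : ∀ {s t} → IsIntegral s → IsIntegral t → 0ℚ < X + t * A → Feas n A C X Y t → g + 1ℚ ≤ s → s < t → Feas n A C X Y s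

-- For positive `A` the sign of `C` decides the shape: with C < 0 the feasible t lie between two
-- roots, with C = 0 they form at most a half-line, and with C > 0 those on the branch x > 0 lie
-- beyond the larger root.
guess : {V : Set} → (n A C X Y : V) → Prog V V
guess n A C X Y =
  lit (+ 0) λ nil → lit (+ 1) λ one → bin mul A C λ AC →
  leq C nil λ nonpos → if nonpos
    then (leq nil C λ nonneg → if nonneg
      then (bin mul X Y λ XY → bin sub n XY λ a → bin mul A Y λ AY → bin fdiv a AY ret)
      else (bin sub nil AC λ c → surd A C X Y n c >>= λ (P , S , Q) →
            bin sub P S λ a → bin sub a one λ b → bin fdiv b Q λ f → bin add f one ret))
    else (surd A C X Y n AC >>= λ (P , S , Q) →
          bin sub S one λ a → bin sub a P λ b → bin fdiv b Q λ f → bin add f one ret)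

pos-factor : ∀ {n x y} → 0ℚ < n → 0ℚ < x → n ≤ x * y → 0ℚ < y
pos-factor {x = x} 0<n 0<x p = pos-cancelˡ x 0<x (<-≤-trans 0<n p)

floor+1≤ : ∀ {Q f t} → 0ℚ < Q → IsIntegral f → IsIntegral t → Q * f < Q * t → f + 1ℚ ≤ t
floor+1≤ {Q} {f} {t} 0<Q i j p = integral-<⇒+1≤ i j (*-cancelˡ-<′ Q f t 0<Q p)

-- A feasible t with x > 0 forces A Y > 0. Otherwise both bounds hold vacuously, which is why the
-- floor property is asked for only under that condition.
guess-linear : ∀ {n A X Y f} → 0ℚ < n → 0ℚ < A → IsIntegral f → (0ℚ < A * Y → IsFloorDiv (n - X * Y) (A * Y) f) → IsGuess n A 0ℚ X Y f
guess-linear {n} {A} {X} {Y} {f} 0<n 0<A f-int f-floor = record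
  { integral = f-int
  ; lower-bound = λ {t} i 0<x feas → *-cancelˡ-≤′ (A * Y) f t (AY>0 {t} 0<x feas) (lo n A X Y t f (IsFloorDiv.lower (f-floor (AY>0 {t} 0<x feas))) feas)
  ; filled = λ {s} {t} i j 0<x feas p q → hi n A X Y s f (<⇒≤ (AY>0 {t} 0<x feas)) (IsFloorDiv.upper (f-floor (AY>0 {t} 0<x feas))) p }
  where
  drop : ∀ Y t → Y + t * 0ℚ ≡ Y
  drop = solve-∀ ℚ-ring
  AY>0 : ∀ {t} → 0ℚ < X + t * A → Feas n A 0ℚ X Y t → 0ℚ < A * Y
  AY>0 {t} 0<x feas = 0<A ⊠< subst (0ℚ <_) (drop Y t) (pos-factor 0<n 0<x feas)
  lo : ∀ n A X Y t f → f * (A * Y) ≤ n - X * Y → n ≤ (X + t * A) * (Y + t * 0ℚ) → A * Y * f ≤ A * Y * t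
  lo n A X Y t f p q = cert (gap p ⊞ gap q) (solve (n ∷ A ∷ X ∷ Y ∷ t ∷ f ∷ []) ℚ-ring)
  hi : ∀ n A X Y t f → 0ℚ ≤ A * Y → n - X * Y < (f + 1ℚ) * (A * Y) → f + 1ℚ ≤ t → n ≤ (X + t * A) * (Y + t * 0ℚ)
  hi n A X Y t f p q r = cert (<⇒≤ (gap< q) ⊞ (p ⊠ gap r)) (solve (n ∷ A ∷ X ∷ Y ∷ t ∷ f ∷ []) ℚ-ring)

guess-concave : ∀ {n A C X Y P S Q f} → 0ℚ < 0ℚ - A * C → IsSurd A C X Y n (0ℚ - A * C) P S Q →
  IsIntegral f → IsFloorDiv (P - S - 1ℚ) Q f → IsGuess n A C X Y (f + 1ℚ)
guess-concave {P = P} {S} {Q} {f} 0<c su f-int f-floor = record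
  { integral = integral-+ f-int integral-1
  ; lower-bound = λ {t} i _ feas → floor+1≤ Q>0 f-int i (below P S Q f t lower (lower-bound {t} feas))
  ; filled = λ {s} {t} i j _ feas p q → between {s} (R≥0 {t} feas) (lo P S Q f s 2≤Q upper p) (hi P S Q s t 2≤Q (integral-<⇒+1≤ i j q) (upper-bound {t} feas)) }
  where
  open Concave su 0<c
  open IsSurd su using (2≤Q; Q>0)
  open IsFloorDiv f-floor
  below : ∀ P S Q f t → f * Q ≤ P - S - 1ℚ → P - Q * t < S + 1ℚ → Q * f < Q * t
  below P S Q f t p q = cert< (gap p ⊞< gap< q) (solve (P ∷ S ∷ Q ∷ f ∷ t ∷ []) ℚ-ring)
  lo : ∀ P S Q f s → 2ℚ ≤ Q → P - S - 1ℚ < (f + 1ℚ) * Q → f + 1ℚ + 1ℚ ≤ s → P - Q * s ≤ S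
  lo P S Q f s 2≤Q p q = cert (((≤-trans (nonNegative⁻¹ 2ℚ) 2≤Q ⊠ gap q) ⊞ <⇒≤ (gap< p)) ⊞ (gap 2≤Q ⊞ 0≤1)) (solve (P ∷ S ∷ Q ∷ f ∷ s ∷ []) ℚ-ring)
  hi : ∀ P S Q s t → 2ℚ ≤ Q → s + 1ℚ ≤ t → Q * t - P < S + 1ℚ → Q * s - P ≤ S
  hi P S Q s t 2≤Q p q = cert (((≤-trans (nonNegative⁻¹ 2ℚ) 2≤Q ⊠ gap p) ⊞ <⇒≤ (gap< q)) ⊞ (gap 2≤Q ⊞ 0≤1)) (solve (P ∷ S ∷ Q ∷ s ∷ t ∷ []) ℚ-ring)

-- Feasible points on the branch satisfy Q t + P ≥ S, and all t with Q t + P ≥ S + 1 are feasible.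
-- The -1 in the numerator makes f < t strict, and Q ≥ 2 puts f + 2 past the second threshold.
guess-convex : ∀ {n A C X Y P S Q f} → 0ℚ < n → 0ℚ < A → 0ℚ < C → IsSurd A C X Y n (A * C) P S Q →
  IsIntegral f → IsFloorDiv (S - 1ℚ - P) Q f → IsGuess n A C X Y (f + 1ℚ)
guess-convex {P = P} {S} {Q} {f} 0<n 0<A 0<C su f-int f-floor = record
  { integral = integral-+ f-int integral-1
  ; lower-bound = λ {t} i 0<x feas → floor+1≤ Q>0 f-int i (below P S Q f t lower
      (lower-bound {t} (<⇒≤ 0<n) (<⇒≤ 0<A) (<⇒≤ 0<C) (<⇒≤ 0<x) (<⇒≤ (pos-factor 0<n 0<x feas)) feas))
  ; filled = λ {s} i j _ feas p q → above {s} (hi P S Q f s 2≤Q upper p) }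
  where
  open Convex su (0<A ⊠< 0<C)
  open IsSurd su using (2≤Q; Q>0)
  open IsFloorDiv f-floor
  below : ∀ P S Q f t → f * Q ≤ S - 1ℚ - P → S ≤ Q * t + P → Q * f < Q * t
  below P S Q f t p q = cert< ((gap p ⊞ gap q) ⊞< 0<1) (solve (P ∷ S ∷ Q ∷ f ∷ t ∷ []) ℚ-ring)
  hi : ∀ P S Q f s → 2ℚ ≤ Q → S - 1ℚ - P < (f + 1ℚ) * Q → f + 1ℚ + 1ℚ ≤ s → S + 1ℚ ≤ Q * s + P
  hi P S Q f s 2≤Q p q = cert (((≤-trans (nonNegative⁻¹ 2ℚ) 2≤Q ⊠ gap q) ⊞ <⇒≤ (gap< p)) ⊞ gap 2≤Q) (solve (P ∷ S ∷ Q ∷ f ∷ s ∷ []) ℚ-ring)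

guess-spec : ∀ n A C X Y → 0ℚ < n → 0ℚ < A → Spec (IsGuess n A C X Y) (guess n A C X Y) 30
guess-spec n A C X Y 0<n 0<A = lit (lit (bin (leq
  (λ C≤0 → leq
    (λ 0≤C → bin (bin (bin (bin (ret (linear (≤-antisym C≤0 0≤C)))))))
    (λ C<0 → bin (Spec-bind (surd-spec A C X Y n _ (concave-coefficient A C 0<A C<0)) λ (P , S , Q) su →
      bin (bin (bin (bin (ret (guess-concave (concave-coefficient A C 0<A C<0) su (fdivℚ-integral (P - S - 1ℚ) Q) (fdivℚ-floor (P - S - 1ℚ) Q (IsSurd.Q>0 su))))))))))
  (λ 0<C → Spec-bind (surd-spec A C X Y n _ (0<A ⊠< 0<C)) λ (P , S , Q) su →
    bin (bin (bin (bin (ret (guess-convex 0<n 0<A 0<C su (fdivℚ-integral (S - 1ℚ - P) Q) (fdivℚ-floor (S - 1ℚ - P) Q (IsSurd.Q>0 su)))))))))))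
  where
  linear : C ≡ 0ℚ → IsGuess n A C X Y (fdivℚ (n - X * Y) (A * Y))
  linear refl = guess-linear 0<n 0<A (fdivℚ-integral (n - X * Y) (A * Y)) (fdivℚ-floor (n - X * Y) (A * Y))

probe : {V : Set} → (n A C X Y t : V) → Prog V (Maybe V)
probe n A C X Y t =
  inside n A C X Y t >>= λ b → if b then ret (just t) else
  (lit (+ 1) λ one → bin add t one λ t′ →
   inside n A C X Y t′ >>= λ b′ → if b′ then ret (just t′) else ret nothing)

-- The invariant of the loop already excludes t = 0 and t = 1, so the search starts at the larger of
-- `g` and 2.
first : {V : Set} → (n A C X Y : V) → Prog V (Maybe V)
first n A C X Y =
  guess n A C X Y >>= λ g → lit (+ 2) λ two →
  leq g two λ b → if b then probe n A C X Y two else probe n A C X Y g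

-- For `just t` it is enough that t - 1 is infeasible: that is the condition on u + (t - 1) v as the
-- next u.
IsFirst : (n A C X Y : ℚ) → Maybe ℚ → Set
IsFirst n A C X Y (just t) = IsIntegral t × 2ℚ ≤ t × Feas n A C X Y t × ¬ Feas n A C X Y (t - 1ℚ)
IsFirst n A C X Y nothing  = ∀ {t} → IsIntegral t → 2ℚ ≤ t → ¬ Feas n A C X Y t

-- Two tests suffice, since a feasible integer beyond T + 1 would make T + 1 feasible as well.
probe-spec : ∀ n A C X Y T → IsIntegral T → 2ℚ ≤ T → ¬ Feas n A C X Y (T - 1ℚ) →
  (∀ {t} → IsIntegral t → 2ℚ ≤ t → Feas n A C X Y t → T ≤ t) →
  (∀ {t} → IsIntegral t → 2ℚ ≤ t → Feas n A C X Y t → T + 1ℚ < t → Feas n A C X Y (T + 1ℚ)) →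
  Spec (IsFirst n A C X Y) (probe n A C X Y T) 14
probe-spec n A C X Y T T-int 2≤T before lower filled = Spec-bind (inside-spec n A C X Y T) λ
  { true f → ret (T-int , 2≤T , f , before)
  ; false ¬f → lit (bin (Spec-bind {d = 0} (inside-spec n A C X Y (T + 1ℚ)) λ
      { true f′ → ret (integral-+ T-int integral-1 , ≤-trans 2≤T (+1-grows T) , f′ , λ f → ¬f (subst (Feas n A C X Y) (+1-1 T) f))
      ; false ¬f′ → ret λ {t} i 2≤t f → none ¬f ¬f′ i 2≤t f })) }
  where
  +1-1 : ∀ T → T + 1ℚ - 1ℚ ≡ T
  +1-1 = solve-∀ ℚ-ring
  +1-grows : ∀ T → T ≤ T + 1ℚ
  +1-grows T = cert 0≤1 (solve (T ∷ []) ℚ-ring)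
  none : ¬ Feas n A C X Y T → ¬ Feas n A C X Y (T + 1ℚ) → ∀ {t} → IsIntegral t → 2ℚ ≤ t → ¬ Feas n A C X Y t
  none ¬f ¬f′ {t} i 2≤t f with T <? t
  ... | no T≮t = ¬f (subst (Feas n A C X Y) (≤-antisym (≮⇒≥ T≮t) (lower i 2≤t f)) f)
  ... | yes T<t with T + 1ℚ <? t
  ...   | yes T+1<t = ¬f′ (filled i 2≤t f T+1<t)
  ...   | no T+1≮t = ¬f′ (subst (Feas n A C X Y) (≤-antisym (≮⇒≥ T+1≮t) (integral-<⇒+1≤ T-int i T<t)) f)

first-spec : ∀ n A C X Y → 0ℚ < n → 0ℚ < A → 0ℚ < X → ¬ Feas n A C X Y 1ℚ → Spec (IsFirst n A C X Y) (first n A C X Y) 46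
first-spec n A C X Y 0<n 0<A 0<X ¬f₁ = Spec-bind (guess-spec n A C X Y 0<n 0<A) λ g isg → lit (leq
  (λ g≤2 → probe-spec n A C X Y 2ℚ 2-int ≤-refl (λ f → ¬f₁ (subst (Feas n A C X Y) 2-1≡1 f)) (λ i 2≤t f → 2≤t)
    (λ {t} i 2≤t f → IsGuess.filled isg {2ℚ + 1ℚ} {t} (integral-+ 2-int integral-1) i (right 2≤t) f (+-monoˡ-≤ 1ℚ g≤2)))
  (λ 2<g → probe-spec n A C X Y g (IsGuess.integral isg) (<⇒≤ 2<g)
    (λ f → <⇒≱ (-1-shrinks g) (IsGuess.lower-bound isg {g - 1ℚ} (integral-sub (IsGuess.integral isg) integral-1) (forward (<⇒≤ (pred-pos g 2<g))) f))
    (λ {t} i 2≤t f → IsGuess.lower-bound isg {t} i (right 2≤t) f)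
    (λ {t} i 2≤t f → IsGuess.filled isg {g + 1ℚ} {t} (integral-+ (IsGuess.integral isg) integral-1) i (right 2≤t) f ≤-refl)))
  where
  2-int : IsIntegral 2ℚ
  2-int = + 2 , refl
  2-1≡1 : 2ℚ - 1ℚ ≡ 1ℚ
  2-1≡1 = refl
  forward : ∀ {t} → 0ℚ ≤ t → 0ℚ < X + t * A
  forward 0≤t = 0<X <⊞ (0≤t ⊠ <⇒≤ 0<A)
  right : ∀ {t} → 2ℚ ≤ t → 0ℚ < X + t * A
  right 2≤t = forward (≤-trans (nonNegative⁻¹ 2ℚ) 2≤t)
  -1-shrinks : ∀ g → g - 1ℚ < g
  -1-shrinks g = cert< 0<1 (solve (g ∷ []) ℚ-ring)
  pred-pos : ∀ g → 2ℚ < g → 0ℚ < g - 1ℚ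
  pred-pos g p = cert< (gap< p <⊞ 0≤1) (solve (g ∷ []) ℚ-ring)

-- The algorithm

Result : Set → Set
Result V = Vec V 7 ⊎ Maybe (V × V)

ray : {V : Set} → (px py x y k : V) → Prog V (Result V)
ray px py x y k =
  bin mul k x λ kx → bin add px kx λ qx → bin mul k y λ ky → bin add py ky λ qy →
  ret (inj₂ (just (qx , qy)))

-- With `ux` = 0 the product along p + k u is linear in k, so the last admissible k is a single
-- quotient.
descend : {V : Set} → (n px py ux uy : V) → Prog V (Result V)
descend n px py ux uy =
  lit (+ 0) λ nil → bin mul px py λ a → bin sub a n λ num →
  bin mul px uy λ b → bin sub nil b λ den → bin fdiv num den λ k → ray px py ux uy k

advance : {V : Set} → (n px py ux uy vx vy : V) → Maybe V → Prog V (Result V)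
advance n px py ux uy vx vy nothing =
  lit (+ 0) λ nil → leq nil vy λ b → if b then ret (inj₂ nothing)
  else (last n vx vy px py >>= ray px py vx vy)
advance n px py ux uy vx vy (just t) =
  bin mul t vx λ tvx → bin add ux tvx λ vx′ → bin mul t vy λ tvy → bin add uy tvy λ vy′ →
  bin sub vx′ vx λ ux′ → bin sub vy′ vy λ uy′ →
  bin add px vx′ λ X → bin add py vy′ λ Y →
  last n ux′ uy′ X Y >>= λ s →
  bin mul s ux′ λ sux → bin add vx′ sux λ vx″ → bin mul s uy′ λ suy → bin add vy′ suy λ vy″ →
  ret (inj₁ (n ∷ᵛ px ∷ᵛ py ∷ᵛ ux′ ∷ᵛ uy′ ∷ᵛ vx″ ∷ᵛ vy″ ∷ᵛ []ᵛ))

-- `init` cannot halt, so the vertical case is tested in the body; after the first iteration the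
-- invariant rules that branch out.
nextpt : Algorithm
nextpt = record
  { k = 7
  ; init = λ { (n ∷ᵛ px ∷ᵛ py ∷ᵛ a ∷ᵛ b ∷ᵛ d ∷ᵛ []ᵛ) →
      lit (+ 0) λ nil → bin sub nil d λ uy → bin add px a λ X → bin add py b λ Y →
      bin mul X Y λ XY → bin sub XY n λ num → bin mul d X λ den → bin fdiv num den λ q →
      bin mul q d λ qd → bin sub b qd λ vy →
      ret (n ∷ᵛ px ∷ᵛ py ∷ᵛ nil ∷ᵛ uy ∷ᵛ a ∷ᵛ vy ∷ᵛ []ᵛ) }
  ; body = λ { (n ∷ᵛ px ∷ᵛ py ∷ᵛ ux ∷ᵛ uy ∷ᵛ vx ∷ᵛ vy ∷ᵛ []ᵛ) →
      bin add px ux λ X → bin add py uy λ Y → bin mul X Y λ XY →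
      leq n XY λ b → if b then descend n px py ux uy
      else (first n vx vy X Y >>= advance n px py ux uy vx vy) }
  }

-- Bases of the lattice

InΛ-shift : ∀ {B u v t} → InΛ B u → InΛ B v → IsIntegral t → InΛ B (u ⊕ (t ⊛ v))
InΛ-shift {B} (a , c , refl) (a′ , c′ , refl) (t , refl) = a ℤ.+ t ℤ.* a′ , c ℤ.+ t ℤ.* c′ ,
  cong₂ _,_ (trans (collect (zℚ a) (zℚ c) (zℚ a′) (zℚ c′) (zℚ t) (b1x B) 0ℚ) (sym coeffs-x)) (trans (collect (zℚ a) (zℚ c) (zℚ a′) (zℚ c′) (zℚ t) (b1y B) (b2y B)) (sym coeffs-y))
  where
  collect : ∀ a c a′ c′ t x y → a * x + c * y + t * (a′ * x + c′ * y) ≡ (a + t * a′) * x + (c + t * c′) * y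
  collect = solve-∀ ℚ-ring
  hom : ∀ a t a′ → zℚ (a ℤ.+ t ℤ.* a′) ≡ zℚ a + zℚ t * zℚ a′
  hom a t a′ = trans (zℚ-+ a (t ℤ.* a′)) (cong (λ x → zℚ a + x) (zℚ-* t a′))
  coeffs-x = cong₂ (λ i j → i * b1x B + j * 0ℚ) (hom a t a′) (hom c t c′)
  coeffs-y = cong₂ (λ i j → i * b1y B + j * b2y B) (hom a t a′) (hom c t c′)

record IsBasis (B : Basis) (u v : Pt) : Set where
  field
    u∈Λ   : InΛ B u
    v∈Λ   : InΛ B v
    span  : ∀ w → InΛ B w → ∃[ α ] ∃[ β ] (IsIntegral α × IsIntegral β × w ≡ (α ⊛ u) ⊕ (β ⊛ v))
    0≤ux  : 0ℚ ≤ proj₁ u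
    ux<vx : proj₁ u < proj₁ v
    det>0 : 0ℚ < proj₁ u * proj₂ v - proj₂ u * proj₁ v

  0<vx : 0ℚ < proj₁ v
  0<vx = ≤-<-trans 0≤ux ux<vx

∣i∣≡1⇒i≡±1 : ∀ i → ℤ.∣ i ∣ ≡ 1 → (i ≡ + 1) ⊎ (i ≡ ℤ.- (+ 1))
∣i∣≡1⇒i≡±1 (+ 1) refl = inj₁ refl
∣i∣≡1⇒i≡±1 -[1+ 0 ] refl = inj₂ refl

unit-factor : ∀ {D α} m → 0ℚ < D → IsIntegral α → D ≡ zℚ m * α * D → (m ≡ + 1) ⊎ (m ≡ ℤ.- (+ 1))
unit-factor {D} m 0<D (z , refl) eq = ∣i∣≡1⇒i≡±1 m (ℕP.m*n≡1⇒m≡1 ℤ.∣ m ∣ ℤ.∣ z ∣ (trans (sym (ℤP.abs-* m z)) (cong ℤ.∣_∣ mz≡1)))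
  where
  c≡1 : zℚ m * zℚ z ≡ 1ℚ
  c≡1 = ≤-antisym
    (*-cancelʳ-≤-pos D {{positive 0<D}} (≤-reflexive (trans (sym eq) (sym (*-identityˡ D)))))
    (*-cancelʳ-≤-pos D {{positive 0<D}} (≤-reflexive (trans (*-identityˡ D) eq)))
  mz≡1 : m ℤ.* z ≡ + 1
  mz≡1 = zℚ-injective (trans (zℚ-* m z) c≡1)

vector-nonzero : ∀ x y → 0ℚ < x ⊎ y < 0ℚ → (x , y) ≢ (0ℚ , 0ℚ)
vector-nonzero x y (inj₁ p) refl = <-irrefl refl p
vector-nonzero x y (inj₂ p) refl = <-irrefl refl p

module _ {B : Basis} {u v : Pt} (bas : IsBasis B u v) where
  open IsBasis bas

  -- If v = m w and w = α u + β v, the determinant with u gives det (u, v) = m β det (u, v), so the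
  -- integers m and β are mutually inverse units.
  v-primitive : Primitive B v
  v-primitive = v∈Λ , vector-nonzero (proj₁ v) (proj₂ v) (inj₁ 0<vx) , λ w m w∈Λ v≡mw → factor w m v≡mw (span w w∈Λ)
    where
    cross : ∀ ux uy vx vy m α β → ux * (m * (α * uy + β * vy)) - uy * (m * (α * ux + β * vx)) ≡ m * β * (ux * vy - uy * vx)
    cross = solve-∀ ℚ-ring
    factor : ∀ w m → v ≡ zℚ m ⊛ w → (∃[ α ] ∃[ β ] (IsIntegral α × IsIntegral β × w ≡ (α ⊛ u) ⊕ (β ⊛ v))) → (m ≡ + 1) ⊎ (m ≡ ℤ.- (+ 1))
    factor w m v≡mw (α , β , _ , j , refl) = unit-factor m det>0 j
      (trans (cong (λ (x , y) → proj₁ u * y - proj₂ u * x) v≡mw) (cross (proj₁ u) (proj₂ u) (proj₁ v) (proj₂ v) (zℚ m) α β))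

  u-primitive : u ≢ (0ℚ , 0ℚ) → Primitive B u
  u-primitive u≢0 = u∈Λ , u≢0 , λ w m w∈Λ u≡mw → factor w m u≡mw (span w w∈Λ)
    where
    cross : ∀ ux uy vx vy m α β → m * (α * ux + β * vx) * vy - m * (α * uy + β * vy) * vx ≡ m * α * (ux * vy - uy * vx)
    cross = solve-∀ ℚ-ring
    factor : ∀ w m → u ≡ zℚ m ⊛ w → (∃[ α ] ∃[ β ] (IsIntegral α × IsIntegral β × w ≡ (α ⊛ u) ⊕ (β ⊛ v))) → (m ≡ + 1) ⊎ (m ≡ ℤ.- (+ 1))
    factor w m u≡mw (α , β , i , _ , refl) = unit-factor m det>0 i
      (trans (cong (λ (x , y) → x * proj₂ v - y * proj₁ v) u≡mw) (cross (proj₁ u) (proj₂ u) (proj₁ v) (proj₂ v) (zℚ m) α β))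

_⊖_ : Pt → Pt → Pt
(a , b) ⊖ (c , d) = (a - c , b - d)

⊖-as-⊕ : ∀ u v → u ⊕ ((- 1ℚ) ⊛ v) ≡ u ⊖ v
⊖-as-⊕ (a , b) (c , d) = cong₂ _,_ (minus a c) (minus b d)
  where
  minus : ∀ a c → a + (- 1ℚ) * c ≡ a - c
  minus = solve-∀ ℚ-ring

module Refine {B : Basis} {u v : Pt} (bas : IsBasis B u v) {t s : ℚ} (t-int : IsIntegral t) (s-int : IsIntegral s) (2≤t : 2ℚ ≤ t) (0≤s : 0ℚ ≤ s) where
  open IsBasis bas

  v′ u′ v″ : Pt
  v′ = u ⊕ (t ⊛ v)
  u′ = v′ ⊖ v
  v″ = v′ ⊕ (s ⊛ u′)

  0<ux′ : 0ℚ < proj₁ u′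
  0<ux′ = pos (proj₁ u) (proj₁ v) t 2≤t 0≤ux 0<vx
    where
    pos : ∀ ux vx t → 2ℚ ≤ t → 0ℚ ≤ ux → 0ℚ < vx → 0ℚ < ux + t * vx - vx
    pos ux vx t p q r = cert< ((q ⊞ (gap p ⊠ <⇒≤ r)) ⊞< r) (solve (ux ∷ vx ∷ t ∷ []) ℚ-ring)

  v′∈Λ : InΛ B v′
  v′∈Λ = InΛ-shift u∈Λ v∈Λ t-int

  u′∈Λ : InΛ B u′
  u′∈Λ = subst (InΛ B) (⊖-as-⊕ v′ v) (InΛ-shift v′∈Λ v∈Λ (integral-neg integral-1))

  -- The change of basis is unimodular: v″ = v + (s + 1) u′ and det (u′, v) = det (u, v). The
  -- coefficients in `recombine` come from the inverse matrix.
  refined : IsBasis B u′ v″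
  refined = record
    { u∈Λ = u′∈Λ
    ; v∈Λ = InΛ-shift v′∈Λ u′∈Λ s-int
    ; span = λ w w∈Λ → respan w (span w w∈Λ)
    ; 0≤ux = <⇒≤ 0<ux′
    ; ux<vx = wider (proj₁ v′) (proj₁ v) s 0<vx 0≤s (<⇒≤ 0<ux′)
    ; det>0 = subst (0ℚ <_) (same-det (proj₁ u) (proj₂ u) (proj₁ v) (proj₂ v) t s) det>0
    }
    where
    wider : ∀ x vx s → 0ℚ < vx → 0ℚ ≤ s → 0ℚ ≤ x - vx → x - vx < x + s * (x - vx)
    wider x vx s p q r = cert< (p <⊞ (q ⊠ r)) (solve (x ∷ vx ∷ s ∷ []) ℚ-ring)
    same-det : ∀ ux uy vx vy t s → ux * vy - uy * vx ≡
      (ux + t * vx - vx) * (uy + t * vy + s * (uy + t * vy - vy)) - (uy + t * vy - vy) * (ux + t * vx + s * (ux + t * vx - vx))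
    same-det = solve-∀ ℚ-ring
    recombine : ∀ x y α β t s → α * x + β * y ≡
      (α * (t - (1ℚ - t) * s) - β * (s + 1ℚ)) * (x + t * y - y) + (α * (1ℚ - t) + β) * (x + t * y + s * (x + t * y - y))
    recombine = solve-∀ ℚ-ring
    1-t : IsIntegral (1ℚ - t)
    1-t = integral-sub integral-1 t-int
    respan : ∀ w → (∃[ α ] ∃[ β ] (IsIntegral α × IsIntegral β × w ≡ (α ⊛ u) ⊕ (β ⊛ v))) →
      ∃[ α ] ∃[ β ] (IsIntegral α × IsIntegral β × w ≡ (α ⊛ u′) ⊕ (β ⊛ v″))
    respan w (α , β , i , j , refl) = _ , _ ,
      integral-sub (integral-* i (integral-sub t-int (integral-* 1-t s-int))) (integral-* j (integral-+ s-int integral-1)) ,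
      integral-+ (integral-* i 1-t) j ,
      cong₂ _,_ (recombine (proj₁ u) (proj₁ v) α β t s) (recombine (proj₂ u) (proj₂ v) α β t s)

-- Convexity of the region x y ≥ n

-- The inequality of arithmetic and geometric means without roots: (x₁ y₂ + x₂ y₁)² = (x₁ y₂ - x₂
-- y₁)² + 4 (x₁ y₁) (x₂ y₂) ≥ (2 n)².
mixed-product : ∀ n x₁ y₁ x₂ y₂ → 0ℚ ≤ n → 0ℚ ≤ x₁ → 0ℚ ≤ y₁ → 0ℚ ≤ x₂ → 0ℚ ≤ y₂ →
  n ≤ x₁ * y₁ → n ≤ x₂ * y₂ → 2ℚ * n ≤ x₁ * y₂ + x₂ * y₁
mixed-product n x₁ y₁ x₂ y₂ 0≤n 0≤x₁ 0≤y₁ 0≤x₂ 0≤y₂ p q = sq-cancel-≤ (2ℚ * n) (x₁ * y₂ + x₂ * y₁) ((0≤x₁ ⊠ 0≤y₂) ⊞ (0≤x₂ ⊠ 0≤y₁))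
  (cert (sq≥0 (x₁ * y₂ - x₂ * y₁) ⊞ (nonNegative⁻¹ 4ℚ ⊠ ((gap p ⊠ (0≤x₂ ⊠ 0≤y₂)) ⊞ (0≤n ⊠ gap q)))) (solve (n ∷ x₁ ∷ y₁ ∷ x₂ ∷ y₂ ∷ []) ℚ-ring))

-- Convexity for the weights k, 1, r, cleared of denominators. In the expanded product the diagonal
-- terms are bounded by membership of the three points, the mixed ones by `mixed-product`.
combination : ∀ n x₀ y₀ x₁ y₁ x₂ y₂ k r → 0ℚ ≤ n → 0ℚ ≤ x₀ → 0ℚ ≤ y₀ → 0ℚ ≤ x₁ → 0ℚ ≤ y₁ → 0ℚ ≤ x₂ → 0ℚ ≤ y₂ → 0ℚ ≤ k → 0ℚ ≤ r →
  n ≤ x₀ * y₀ → n ≤ x₁ * y₁ → n ≤ x₂ * y₂ →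
  (k + 1ℚ + r) * (k + 1ℚ + r) * n ≤ (k * x₀ + x₁ + r * x₂) * (k * y₀ + y₁ + r * y₂)
combination n x₀ y₀ x₁ y₁ x₂ y₂ k r 0≤n a b c d e f 0≤k 0≤r p₀ p₁ p₂ = cert
  (((0≤k ⊠ 0≤k) ⊠ gap p₀) ⊞ gap p₁ ⊞ ((0≤r ⊠ 0≤r) ⊠ gap p₂)
   ⊞ (0≤k ⊠ gap (mixed-product n x₀ y₀ x₁ y₁ 0≤n a b c d p₀ p₁))
   ⊞ ((0≤k ⊠ 0≤r) ⊠ gap (mixed-product n x₀ y₀ x₂ y₂ 0≤n a b e f p₀ p₂))
   ⊞ (0≤r ⊠ gap (mixed-product n x₁ y₁ x₂ y₂ 0≤n c d e f p₁ p₂)))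
  (identity n x₀ y₀ x₁ y₁ x₂ y₂ k r)
  where
  identity : ∀ n x₀ y₀ x₁ y₁ x₂ y₂ k r →
    k * k * (x₀ * y₀ - n) + (x₁ * y₁ - n) + r * r * (x₂ * y₂ - n)
    + k * (x₀ * y₁ + x₁ * y₀ - 2ℚ * n) + k * r * (x₀ * y₂ + x₂ * y₀ - 2ℚ * n) + r * (x₁ * y₂ + x₂ * y₁ - 2ℚ * n)
    ≡ (k * x₀ + x₁ + r * x₂) * (k * y₀ + y₁ + r * y₂) - (k + 1ℚ + r) * (k + 1ℚ + r) * n
  identity = solve-∀ ℚ-ring

-- If p, p + v and p + w lie in the region, where w = α u + β v with α ≥ 1, put
-- j = ⌈β/α⌉ and r = α j − β ∈ [0, α − 1].  Then p + u + j v is the convex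
-- combination of p, p + w, p + v with weights (α − 1 − r, 1, r) / α.
level-one : ∀ n px py ux uy vx vy α β → 0ℚ < n → 0ℚ < px → 0ℚ < py → n ≤ px * py →
  0ℚ < vx → n ≤ (px + vx) * (py + vy) →
  IsIntegral α → IsIntegral β → 1ℚ ≤ α → 0ℚ ≤ α * ux + β * vx →
  n ≤ (px + (α * ux + β * vx)) * (py + (α * uy + β * vy)) →
  ∃[ j ] (IsIntegral j × 0ℚ ≤ ux + j * vx × Feas n vx vy (px + ux) (py + uy) j)
level-one n px py ux uy vx vy α β 0<n 0<px 0<py p∈H 0<vx v∈H i₁ i₂ 1≤α 0≤wx w∈H =
  conclude (- β) (fdivℚ (- β) α) (fdivℚ-integral (- β) α) (fdivℚ-floor (- β) α 0<α) refl
  where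
  0<α : 0ℚ < α
  0<α = <-≤-trans 0<1 1≤α
  conclude : ∀ b q → IsIntegral q → IsFloorDiv b α q → b ≡ - β →
    ∃[ j ] (IsIntegral j × 0ℚ ≤ ux + j * vx × Feas n vx vy (px + ux) (py + uy) j)
  conclude b q q-int fl refl = - q , integral-neg q-int ,
    nonneg-cancelˡ α 0<α (cert (0≤wx ⊞ (0≤r ⊠ <⇒≤ 0<vx)) (x-identity ux vx α β q)) ,
    *-cancelˡ-≤′ (α * α) n _ (0<α ⊠< 0<α) (subst₂ _≤_ (left α r n) (right px py ux uy vx vy α β q)
      (combination n px py wx wy (px + vx) (py + vy) (α - 1ℚ - r) r (<⇒≤ 0<n) (<⇒≤ 0<px) (<⇒≤ 0<py) (<⇒≤ 0<wx) (<⇒≤ (pos-factor 0<n 0<wx w∈H))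
        (<⇒≤ 0<px+vx) (<⇒≤ (pos-factor 0<n 0<px+vx v∈H)) (slack α r r+1≤α) 0≤r p∈H w∈H v∈H))
    where
    wx = px + (α * ux + β * vx)
    wy = py + (α * uy + β * vy)
    r = (- β) - q * α
    0≤r : 0ℚ ≤ r
    0≤r = gap (IsFloorDiv.lower fl)
    r<α : r < α
    r<α = rearrange (- β) q α (IsFloorDiv.upper fl)
      where
      rearrange : ∀ b q α → b < (q + 1ℚ) * α → b - q * α < α
      rearrange b q α p = cert< (gap< p) (solve (b ∷ q ∷ α ∷ []) ℚ-ring)
    r+1≤α : r + 1ℚ ≤ α
    r+1≤α = integral-<⇒+1≤ (integral-sub (integral-neg i₂) (integral-* q-int i₁)) i₁ r<α
    slack : ∀ α r → r + 1ℚ ≤ α → 0ℚ ≤ α - 1ℚ - r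
    slack α r p = cert (gap p) (solve (α ∷ r ∷ []) ℚ-ring)
    0<wx : 0ℚ < wx
    0<wx = 0<px <⊞ 0≤wx
    0<px+vx : 0ℚ < px + vx
    0<px+vx = 0<px <⊞ <⇒≤ 0<vx
    x-identity : ∀ ux vx α β q → α * ux + β * vx + ((- β) - q * α) * vx ≡ α * (ux + (- q) * vx) - 0ℚ
    x-identity = solve-∀ ℚ-ring
    left : ∀ α r n → (α - 1ℚ - r + 1ℚ + r) * (α - 1ℚ - r + 1ℚ + r) * n ≡ α * α * n
    left = solve-∀ ℚ-ring
    right : ∀ px py ux uy vx vy α β q →
      ((α - 1ℚ - ((- β) - q * α)) * px + (px + (α * ux + β * vx)) + ((- β) - q * α) * (px + vx)) *
      ((α - 1ℚ - ((- β) - q * α)) * py + (py + (α * uy + β * vy)) + ((- β) - q * α) * (py + vy)) ≡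
      α * α * ((px + ux + (- q) * vx) * (py + uy + (- q) * vy))
    right = solve-∀ ℚ-ring

-- One iteration of the loop

i≤∣i∣ : ∀ i → i ℤ.≤ + ℤ.∣ i ∣
i≤∣i∣ (+ _)    = ℤP.≤-refl
i≤∣i∣ -[1+ _ ] = ℤ.-≤+

module Search (n px py : ℚ) (B : Basis) (0<n : 0ℚ < n) (p∈H : InH n (px , py)) where

  p : Pt
  p = px , py

  p-in : n ≤ px * py
  p-in = proj₂ (proj₂ p∈H)

  0<px : 0ℚ < px
  0<px = ≰⇒> λ px≤0 → <⇒≱ 0<n (≤-trans p-in (cert (gap px≤0 ⊠ proj₁ (proj₂ p∈H)) (identity px py)))
    where
    identity : ∀ x y → (0ℚ - x) * y ≡ 0ℚ - x * y
    identity = solve-∀ ℚ-ring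

  0<py : 0ℚ < py
  0<py = pos-factor 0<n 0<px p-in

  InH-intro : ∀ {x y} → 0ℚ < x → n ≤ x * y → InH n (x , y)
  InH-intro 0<x le = <⇒≤ 0<x , <⇒≤ (pos-factor 0<n 0<x le) , le

  -- The region is closed under adding vectors with nonnegative coordinates, so a step to the right
  -- that leaves it must go down.
  out⇒y<0 : ∀ x y → 0ℚ ≤ x → ¬ (n ≤ (px + x) * (py + y)) → y < 0ℚ
  out⇒y<0 x y 0≤x out = ≰⇒> λ 0≤y → out (≤-trans p-in (cert ((<⇒≤ 0<px ⊠ 0≤y) ⊞ (0≤x ⊠ (<⇒≤ 0<py ⊞ 0≤y))) (identity px py x y)))
    where
    identity : ∀ px py x y → px * y + x * (py + y) ≡ (px + x) * (py + y) - px * py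
    identity = solve-∀ ℚ-ring

  record State (u v : Pt) : Set where
    field
      isBasis : IsBasis B u v
      u-out   : ¬ (n ≤ (px + proj₁ u) * (py + proj₂ u))
      u+v-out : ¬ Feas n (proj₁ v) (proj₂ v) (px + proj₁ u) (py + proj₂ u) 1ℚ
      v-in    : n ≤ (px + proj₁ v) * (py + proj₂ v)

    open IsBasis isBasis public

    uy<0 : proj₂ u < 0ℚ
    uy<0 = out⇒y<0 (proj₁ u) (proj₂ u) 0≤ux u-out

  module _ {u v : Pt} (st : State u v) where
    open State st

    ux = proj₁ u
    uy = proj₂ u
    vx = proj₁ v
    vy = proj₂ v

    -- A negative j would put u + j v to the left of the axis because u_x < v_x; j = 0 and j = 1 are
    -- excluded by the invariant, and j ≥ 2 by the search.
    empty-level : (∀ {t} → IsIntegral t → 2ℚ ≤ t → ¬ Feas n vx vy (px + ux) (py + uy) t) →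
      ∀ {j} → IsIntegral j → 0ℚ ≤ ux + j * vx → ¬ Feas n vx vy (px + ux) (py + uy) j
    empty-level none {j} j-int 0≤x f with j <? 0ℚ
    ... | yes j<0 = <⇒≱ (left ux vx j ux<vx (<⇒≤ 0<vx) (integral-<⇒+1≤ j-int integral-0 j<0)) 0≤x
      where
      left : ∀ ux vx j → ux < vx → 0ℚ ≤ vx → j + 1ℚ ≤ 0ℚ → ux + j * vx < 0ℚ
      left ux vx j a b c = cert< (gap< a <⊞ (gap c ⊠ b)) (solve (ux ∷ vx ∷ j ∷ []) ℚ-ring)
    ... | no j≮0 = [ (λ j≡0 → u-out (subst (n ≤_) (at-0 (px + ux) (py + uy) vx vy) (subst (Feas n vx vy (px + ux) (py + uy)) j≡0 f)))
                   , (λ 1≤j → [ (λ j-1≡0 → u+v-out (subst (Feas n vx vy (px + ux) (py + uy)) (from-1 j j-1≡0) f))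
                              , (λ 1≤j-1 → none j-int (above-2 j 1≤j-1) f) ]′ (integral-nonneg-cases (integral-sub j-int integral-1) (gap 1≤j))) ]′
                   (integral-nonneg-cases j-int (≮⇒≥ j≮0))
      where
      at-0 : ∀ X Y A C → (X + 0ℚ * A) * (Y + 0ℚ * C) ≡ X * Y
      at-0 = solve-∀ ℚ-ring
      from-1 : ∀ j → j - 1ℚ ≡ 0ℚ → j ≡ 1ℚ
      from-1 j e = trans (shift j) (cong (_+ 1ℚ) e)
        where
        shift : ∀ j → j ≡ j - 1ℚ + 1ℚ
        shift = solve-∀ ℚ-ring
      above-2 : ∀ j → 1ℚ ≤ j - 1ℚ → 2ℚ ≤ j
      above-2 j q = cert (gap q) (solve (j ∷ []) ℚ-ring)

    -- For w = α u + β v the slope comparison equals -α det (u, v). Only α ≥ 1 could beat v, and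
    -- then `level-one` would produce a point that `empty-level` forbids.
    minimal : (∀ {t} → IsIntegral t → 2ℚ ≤ t → ¬ Feas n vx vy (px + ux) (py + uy) t) → IsMinsl n B p v
    minimal none = v-primitive isBasis ,
      (v , 1ℚ , (v∈Λ , proj₁ (proj₂ (v-primitive isBasis)) , <⇒≤ 0<vx , InH-intro (0<px <⊞ <⇒≤ 0<vx) v-in) , 0<1 , cong₂ _,_ (sym (*-identityˡ vx)) (sym (*-identityˡ vy))) ,
      λ w (w∈Λ , _ , 0≤wx , w∈H) → slope w (span w w∈Λ) 0≤wx (proj₂ (proj₂ w∈H))
      where
      cross : ∀ ux uy vx vy α β → (0ℚ - α) * (ux * vy - uy * vx) ≡ vx * (α * uy + β * vy) - vy * (α * ux + β * vx) - 0ℚ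
      cross = solve-∀ ℚ-ring
      slope : ∀ w → (∃[ α ] ∃[ β ] (IsIntegral α × IsIntegral β × w ≡ (α ⊛ u) ⊕ (β ⊛ v))) → 0ℚ ≤ proj₁ w →
        n ≤ (px + proj₁ w) * (py + proj₂ w) → SlopeLE v w
      slope w (α , β , i , j , refl) 0≤wx w∈H with 0ℚ <? α
      ... | no α≤0 = cert (gap (≮⇒≥ α≤0) ⊠ <⇒≤ det>0) (cross ux uy vx vy α β)
      ... | yes 0<α = ⊥-elim (contra (level-one n px py ux uy vx vy α β 0<n 0<px 0<py p-in 0<vx v-in i j (subst (_≤ α) (+-identityˡ 1ℚ) (integral-<⇒+1≤ integral-0 i 0<α)) 0≤wx w∈H))
        where
        contra : ¬ (∃[ j ] (IsIntegral j × 0ℚ ≤ ux + j * vx × Feas n vx vy (px + ux) (py + uy) j))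
        contra (j , j-int , 0≤x , f) = empty-level none j-int 0≤x f

  regs : Pt → Pt → Vec ℚ 7
  regs u v = n ∷ᵛ px ∷ᵛ py ∷ᵛ proj₁ u ∷ᵛ proj₂ u ∷ᵛ proj₁ v ∷ᵛ proj₂ v ∷ᵛ []ᵛ

  data Step (u v : Pt) : Result ℚ → Set where
    halt : ∀ {out} → IsNextpt n B p out → Step u v (inj₂ out)
    move : ∀ {u′ v′} → State u′ v′ →
      (proj₂ v < 0ℚ → proj₂ v′ ≤ proj₂ v + proj₂ v) →
      (0ℚ ≤ proj₂ v → 0ℚ ≤ proj₂ v′ → - proj₂ u′ + - proj₂ u′ ≤ - proj₂ u) →
      Step u v (inj₁ (regs u′ v′))

  Halted : Result ℚ → Set
  Halted (inj₁ _)   = ⊥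
  Halted (inj₂ out) = IsNextpt n B p out

  ray-spec : ∀ {P : Result ℚ → Set} x y k → P (inj₂ (just (p ⊕ (k ⊛ (x , y))))) → Spec P (ray px py x y k) 4
  ray-spec x y k nx = bin (bin (bin (bin (ret nx))))

  nextpt-last : ∀ {v k} → IsMinsl n B p v → 0ℚ ≤ proj₁ v → IsIntegral k → 0ℚ ≤ k → Feas n (proj₁ v) (proj₂ v) px py k →
    (∀ {t} → IsIntegral t → Feas n (proj₁ v) (proj₂ v) px py t → t ≤ k) → IsNextpt n B p (just (p ⊕ (k ⊛ v)))
  nextpt-last {v} {k} min 0≤vx (z , refl) 0≤k f max = v , min , z , refl , InH-intro (0<px <⊞ (0≤k ⊠ 0≤vx)) f ,
    λ j q∈H → zℚ-cancel-≤ j z (max (j , refl) (proj₂ (proj₂ q∈H)))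

  nextpt-∞ : ∀ {v} → IsMinsl n B p v → 0ℚ ≤ proj₁ v → 0ℚ ≤ proj₂ v → IsNextpt n B p nothing
  nextpt-∞ {v} min 0≤vx 0≤vy = v , min , λ j → + ℤ.∣ j ∣ , i≤∣i∣ j , InH-intro (0<px <⊞ (zℕ-nonneg ℤ.∣ j ∣ ⊠ 0≤vx)) (far px py (proj₁ v) (proj₂ v) (zℚ (+ ℤ.∣ j ∣)) (zℕ-nonneg ℤ.∣ j ∣) (<⇒≤ 0<px) (<⇒≤ 0<py) 0≤vx 0≤vy p-in)
    where
    far : ∀ px py vx vy j → 0ℚ ≤ j → 0ℚ ≤ px → 0ℚ ≤ py → 0ℚ ≤ vx → 0ℚ ≤ vy → n ≤ px * py → n ≤ (px + j * vx) * (py + j * vy)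
    far px py vx vy j 0≤j 0≤px 0≤py 0≤vx 0≤vy le = ≤-trans le (cert ((0≤j ⊠ 0≤vx ⊠ 0≤py) ⊞ (0≤px ⊞ 0≤j ⊠ 0≤vx) ⊠ (0≤j ⊠ 0≤vy)) (solve (px ∷ py ∷ vx ∷ vy ∷ j ∷ []) ℚ-ring))

  advance-nothing : ∀ {u v} → State u v → IsFirst n (proj₁ v) (proj₂ v) (px + proj₁ u) (py + proj₂ u) nothing →
    Spec (Step u v) (advance n px py (proj₁ u) (proj₂ u) (proj₁ v) (proj₂ v) nothing) 40
  advance-nothing {u} {v} st none = lit (leq
    (λ 0≤vy → ret (halt (nextpt-∞ (minimal st none) (<⇒≤ 0<vx) 0≤vy)))
    (λ vy<0 → Spec-bind (last-spec n (proj₁ v) (proj₂ v) px py 0<vx vy<0 p-in) λ s l →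
      ray-spec (proj₁ v) (proj₂ v) s (halt (nextpt-last (minimal st none) (<⇒≤ 0<vx) (IsLast.integral l) (IsLast.nonneg l) (IsLast.feasible l) (IsLast.maximal l)))))
    where open State st

  module _ {u v : Pt} (st : State u v) {t : ℚ} (t-int : IsIntegral t) (2≤t : 2ℚ ≤ t)
    (t-in : Feas n (proj₁ v) (proj₂ v) (px + proj₁ u) (py + proj₂ u) t)
    (t-1-out : ¬ Feas n (proj₁ v) (proj₂ v) (px + proj₁ u) (py + proj₂ u) (t - 1ℚ)) where
    open State st

    v′ u′ : Pt
    v′ = u ⊕ (t ⊛ v)
    u′ = v′ ⊖ v

    0<ux′ : 0ℚ < proj₁ u′
    0<ux′ = Refine.0<ux′ isBasis t-int integral-0 2≤t ≤-refl

    u′-out : ¬ (n ≤ (px + proj₁ u′) * (py + proj₂ u′))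
    u′-out le = t-1-out (subst (n ≤_) (cong₂ _*_ (back px (proj₁ u) (proj₁ v) t) (back py (proj₂ u) (proj₂ v) t)) le)
      where
      back : ∀ p x y t → p + (x + t * y - y) ≡ p + x + (t - 1ℚ) * y
      back = solve-∀ ℚ-ring

    uy′<0 : proj₂ u′ < 0ℚ
    uy′<0 = out⇒y<0 (proj₁ u′) (proj₂ u′) (<⇒≤ 0<ux′) u′-out

    v′-in : n ≤ (px + proj₁ v′) * (py + proj₂ v′)
    v′-in = subst (n ≤_) (cong₂ _*_ (+-assoc px (proj₁ u) (t * proj₁ v)) (+-assoc py (proj₂ u) (t * proj₂ v))) t-in

    module _ {s : ℚ} (l : IsLast n (proj₁ u′) (proj₂ u′) (px + proj₁ v′) (py + proj₂ v′) s) where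
      open IsLast l

      v″ : Pt
      v″ = v′ ⊕ (s ⊛ u′)

      moved-state : State u′ v″
      moved-state = record
        { isBasis = Refine.refined isBasis t-int integral 2≤t nonneg
        ; u-out = u′-out
        -- The point p + u′ + v″ is slide number s + 1, excluded by the maximality of s.
        ; u+v-out = λ f → <⇒≱ (grows s) (maximal (integral-+ integral integral-1)
            (subst (n ≤_) (cong₂ _*_ (next px (proj₁ u′) (proj₁ v′) s) (next py (proj₂ u′) (proj₂ v′) s)) f))
        ; v-in = subst (n ≤_) (cong₂ _*_ (+-assoc px (proj₁ v′) (s * proj₁ u′)) (+-assoc py (proj₂ v′) (s * proj₂ u′))) feasible }
        where
        grows : ∀ s → s < s + 1ℚ
        grows s = cert< 0<1 (solve (s ∷ []) ℚ-ring)
        next : ∀ p x y s → p + x + 1ℚ * (y + s * x) ≡ p + y + (s + 1ℚ) * x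
        next = solve-∀ ℚ-ring

      doubling : proj₂ v < 0ℚ → proj₂ v″ ≤ proj₂ v + proj₂ v
      doubling vy<0 = bound (proj₂ u) (proj₂ v) (proj₂ u′) t s uy<0 vy<0 uy′<0 2≤t nonneg
        where
        bound : ∀ uy vy uy′ t s → uy < 0ℚ → vy < 0ℚ → uy′ < 0ℚ → 2ℚ ≤ t → 0ℚ ≤ s → uy + t * vy + s * uy′ ≤ vy + vy
        bound uy vy uy′ t s a b c d e = cert (<⇒≤ (gap< a) ⊞ (gap d ⊠ <⇒≤ (gap< b)) ⊞ (e ⊠ <⇒≤ (gap< c))) (solve (uy ∷ vy ∷ uy′ ∷ t ∷ s ∷ []) ℚ-ring)

      -- Since u′_y < 0, v″_y ≥ 0 forces v′_y ≥ 0, that is -u′_y ≤ v_y. Now -u_y = -u′_y + (t - 1)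
      -- v_y with t - 1 ≥ 1.
      halving : 0ℚ ≤ proj₂ v → 0ℚ ≤ proj₂ v″ → - proj₂ u′ + - proj₂ u′ ≤ - proj₂ u
      halving 0≤vy 0≤vy″ = bound (proj₂ u) (proj₂ v) t 0≤vy 2≤t (≤-trans 0≤vy″ (drop (proj₂ v′) (proj₂ u′) s uy′<0 nonneg))
        where
        drop : ∀ y uy′ s → uy′ < 0ℚ → 0ℚ ≤ s → y + s * uy′ ≤ y
        drop y uy′ s a b = cert (b ⊠ <⇒≤ (gap< a)) (solve (y ∷ uy′ ∷ s ∷ []) ℚ-ring)
        bound : ∀ uy vy t → 0ℚ ≤ vy → 2ℚ ≤ t → 0ℚ ≤ uy + t * vy → - (uy + t * vy - vy) + - (uy + t * vy - vy) ≤ - uy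
        bound uy vy t a b c = cert ((gap b ⊠ a) ⊞ c) (solve (uy ∷ vy ∷ t ∷ []) ℚ-ring)

    advance-just : Spec (Step u v) (advance n px py (proj₁ u) (proj₂ u) (proj₁ v) (proj₂ v) (just t)) 46
    advance-just = bin (bin (bin (bin (bin (bin (bin (bin (Spec-bind
      (last-spec n (proj₁ u′) (proj₂ u′) (px + proj₁ v′) (py + proj₂ v′) 0<ux′ uy′<0 v′-in) λ s l →
      bin (bin (bin (bin (ret (move (moved-state l) (doubling l) (halving l))))))))))))))

  -- The bound is 96 = 4 + 46 + 46: the test in the body, `first`, and the costlier case of
  -- `advance`.
  body-spec : ∀ {u v} → State u v → Spec (Step u v) (body nextpt (regs u v)) 96
  body-spec {u} {v} st = bin (bin (bin (leq (λ le → ⊥-elim (u-out le)) (λ _ →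
    Spec-bind (first-spec n (proj₁ v) (proj₂ v) (px + proj₁ u) (py + proj₂ u) 0<n 0<vx (0<px <⊞ 0≤ux) u+v-out) λ
      { nothing none → Spec-weaken (ℕP.m≤m+n 40 6) (advance-nothing st none)
      ; (just t) (t-int , 2≤t , t-in , t-1-out) → advance-just st t-int 2≤t t-in t-1-out }))))
    where open State st

  body-vertical : ∀ {uy v} → IsBasis B (0ℚ , uy) v → uy < 0ℚ → n ≤ (px + 0ℚ) * (py + uy) →
    Spec Halted (body nextpt (regs (0ℚ , uy) v)) 96
  body-vertical {uy} {v} bas uy<0 u-in = bin (bin (bin (leq
    (λ _ → lit (bin (bin (bin (bin (bin landing))))))
    (λ out → ⊥-elim (<⇒≱ out u-in)))))
    where
    open IsBasis bas
    den>0 : 0ℚ < 0ℚ - px * uy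
    den>0 = concave-coefficient px uy 0<px uy<0
    u≢0 : (0ℚ , uy) ≢ (0ℚ , 0ℚ)
    u≢0 = vector-nonzero 0ℚ uy (inj₂ uy<0)
    min : IsMinsl n B p (0ℚ , uy)
    min = u-primitive bas u≢0 ,
      ((0ℚ , uy) , 1ℚ , (u∈Λ , u≢0 , ≤-refl , InH-intro (0<px <⊞ ≤-refl) u-in) , 0<1 , cong₂ _,_ refl (sym (*-identityˡ uy))) ,
      λ (x , y) (_ , _ , 0≤x , _) → slope x y 0≤x
      where
      slope : ∀ x y → 0ℚ ≤ x → 0ℚ ≤ 0ℚ * y - uy * x
      slope x y 0≤x = cert (<⇒≤ (gap< uy<0) ⊠ 0≤x) (identity uy x y)
        where
        identity : ∀ uy x y → (0ℚ - uy) * x ≡ 0ℚ * y - uy * x - 0ℚ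
        identity = solve-∀ ℚ-ring
    down : ∀ {k} → IsIntegral k → IsFloorDiv (px * py - n) (0ℚ - px * uy) k → IsNextpt n B p (just (p ⊕ (k ⊛ (0ℚ , uy))))
    down {k} k-int fl = nextpt-last min ≤-refl k-int
      (≤-pred-integral integral-0 k-int (bound 0ℚ integral-0 (Feas-0 n 0ℚ uy px py p-in)))
      (inside-k n px py uy k (IsFloorDiv.lower fl))
      (λ {t} i f → ≤-pred-integral i k-int (bound t i f))
      where
      inside-k : ∀ n px py uy k → k * (0ℚ - px * uy) ≤ px * py - n → n ≤ (px + k * 0ℚ) * (py + k * uy)
      inside-k n px py uy k le = cert (gap le) (solve (n ∷ px ∷ py ∷ uy ∷ k ∷ []) ℚ-ring)
      scaled : ∀ n px py uy k t → px * py - n < (k + 1ℚ) * (0ℚ - px * uy) → n ≤ (px + t * 0ℚ) * (py + t * uy) → (0ℚ - px * uy) * t < (0ℚ - px * uy) * (k + 1ℚ)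
      scaled n px py uy k t a b = cert< (gap b ⊞< gap< a) (solve (n ∷ px ∷ py ∷ uy ∷ k ∷ t ∷ []) ℚ-ring)
      bound : ∀ t → IsIntegral t → Feas n 0ℚ uy px py t → t < k + 1ℚ
      bound t i f = *-cancelˡ-<′ (0ℚ - px * uy) t (k + 1ℚ) den>0 (scaled n px py uy k t (IsFloorDiv.upper fl) f)
    landing : Spec Halted (ray px py 0ℚ uy (fdivℚ (px * py - n) (0ℚ - px * uy))) 86
    landing = Spec-weaken (ℕP.m≤m+n 4 82) (ray-spec 0ℚ uy _
      (down (fdivℚ-integral (px * py - n) (0ℚ - px * uy)) (fdivℚ-floor (px * py - n) (0ℚ - px * uy) den>0)))

-- Running the loop

loop-halt : ∀ A s acc {out c} → exec (body A s) ≡ (inj₂ out , c) → loop A 1 s acc ≡ just (out , acc ℕ.+ c)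
loop-halt A s acc eq rewrite eq = refl

loop-move : ∀ A fuel s acc {s′ c} → exec (body A s) ≡ (inj₁ s′ , c) → loop A (suc fuel) s acc ≡ loop A fuel s′ (acc ℕ.+ c)
loop-move A fuel s acc eq rewrite eq = refl

-- Fuel does not influence the result once it suffices, so the cost bound of one run carries over to
-- every run.
loop-deterministic : ∀ A f g s acc {x y} → loop A f s acc ≡ just x → loop A g s acc ≡ just y → x ≡ y
loop-deterministic A (suc f) (suc g) s acc p q with exec (body A s)
... | inj₁ s′ , c = loop-deterministic A f g s′ (acc ℕ.+ c) p q
... | inj₂ out , c with refl ← p | refl ← q = refl

-- Counting the iterations by powers of two

pow2 : ℕ → ℚ
pow2 m = zℚ (+ (2 ℕ.^ m))

pow2-suc : ∀ m → pow2 (suc m) ≡ pow2 m + pow2 m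
pow2-suc m = trans (cong (λ k → zℚ (+ (2 ℕ.^ m ℕ.+ k))) (ℕP.+-identityʳ (2 ℕ.^ m))) (zℚ-+ (+ (2 ℕ.^ m)) (+ (2 ℕ.^ m)))

1≤pow2 : ∀ m → 1ℚ ≤ pow2 m
1≤pow2 m = zℚ-mono-≤ {+ 1} (ℤ.+≤+ (ℕP.m^n>0 2 m))

pow2-nonneg : ∀ m → 0ℚ ≤ pow2 m
pow2-nonneg m = zℕ-nonneg (2 ℕ.^ m)

n<2^n : ∀ n → n ℕ.< 2 ℕ.^ n
n<2^n zero = s≤s z≤n
n<2^n (suc n) = ℕP.+-mono-≤ (ℕP.m^n>0 2 n) (ℕP.≤-trans (n<2^n n) (ℕP.m≤m+n (2 ℕ.^ n) 0))

pow2-archimedean : ∀ x y → 0ℚ < y → ∃[ m ] (x < pow2 m * y)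
pow2-archimedean x y 0<y = bound (fdivℚ x y) (fdivℚ-integral x y) (IsFloorDiv.upper (fdivℚ-floor x y 0<y))
  where
  bound : ∀ q → IsIntegral q → x < (q + 1ℚ) * y → ∃[ m ] (x < pow2 m * y)
  bound q (z , refl) p = m , <-≤-trans p (*-monoʳ-≤-nonNeg y {{nonNegative (<⇒≤ 0<y)}} q+1≤)
    where
    m = ℤ.∣ z ℤ.+ + 1 ∣
    q+1≤ : zℚ z + 1ℚ ≤ pow2 m
    q+1≤ = subst (_≤ pow2 m) (zℚ-+ z (+ 1)) (≤-trans (zℚ-mono-≤ (i≤∣i∣ (z ℤ.+ + 1))) (zℚ-mono-≤ (ℤ.+≤+ (ℕP.<⇒≤ (n<2^n m)))))

n<2^1+log : ∀ n → n ℕ.< 2 ℕ.^ suc ⌊log₂ n ⌋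
n<2^1+log n = ℕP.≰⇒> λ le → ℕP.<-irrefl refl (subst (ℕ._≤ ⌊log₂ n ⌋) (⌊log₂[2^n]⌋≡n (suc ⌊log₂ n ⌋)) (⌊log₂⌋-mono-≤ le))

-- Discreteness of the y-projection: a nonzero y-coordinate has absolute value at least g.
YMultiples : Basis → ℚ → Set
YMultiples B g = ∀ w → InΛ B w → ∃[ z ] (IsIntegral z × proj₂ w ≡ z * g)

multiple-neg : ∀ {g y} → 0ℚ < g → (∃[ z ] (IsIntegral z × y ≡ z * g)) → y < 0ℚ → g ≤ - y
multiple-neg {g} 0<g (z , i , refl) y<0 = scale g z (<⇒≤ 0<g) (integral-<⇒+1≤ i integral-0 z<0)
  where
  z<0 : z < 0ℚ
  z<0 = *-cancelˡ-<′ g z 0ℚ 0<g (subst₂ _<_ (*-comm z g) (sym (*-zeroʳ g)) y<0)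
  scale : ∀ g z → 0ℚ ≤ g → z + 1ℚ ≤ 0ℚ → g ≤ - (z * g)
  scale g z a b = cert (gap b ⊠ a) (solve (g ∷ z ∷ []) ℚ-ring)

neg-0- : ∀ d → d ≡ - (0ℚ - d)
neg-0- = solve-∀ ℚ-ring

module Run (n px py : ℚ) (B : Basis) (0<n : 0ℚ < n) (p∈H : InH n (px , py)) where
  open Search n px py B 0<n p∈H

  Terminates : Vec ℚ 7 → ℕ → Set
  Terminates s N = ∀ acc → ∃[ fuel ] ∃[ out ] ∃[ cost ] (loop nextpt fuel s acc ≡ just (out , cost) × IsNextpt n B p out × cost ℕ.≤ acc ℕ.+ N ℕ.* 96)

  Terminates-weaken : ∀ {s M N} → M ℕ.≤ N → Terminates s M → Terminates s N
  Terminates-weaken M≤N t acc with fuel , out , cost , eq , nx , le ← t acc =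
    fuel , out , cost , eq , nx , ℕP.≤-trans le (ℕP.+-monoʳ-≤ acc (ℕP.*-monoˡ-≤ 96 M≤N))

  Terminates-sound : ∀ {s N} → Terminates s N → ∀ acc → ∃[ out ] ∃[ cost ] ((∃[ fuel ] (loop nextpt fuel s acc ≡ just (out , cost))) × IsNextpt n B p out)
  Terminates-sound t acc with fuel , out , cost , eq , nx , _ ← t acc = out , cost , (fuel , eq) , nx

  Terminates-cost : ∀ {s N} → Terminates s N → ∀ acc fuel {out cost} → loop nextpt fuel s acc ≡ just (out , cost) → cost ℕ.≤ acc ℕ.+ N ℕ.* 96
  Terminates-cost {s} t acc fuel eq with fuel′ , out′ , cost′ , eq′ , _ , le ← t acc
    with refl ← loop-deterministic nextpt fuel′ fuel s acc eq′ eq = le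

  iterate : ∀ {s N} {P : Result ℚ → Set} → Spec P (body nextpt s) 96 →
    (∀ {out} → P (inj₂ out) → IsNextpt n B p out) → (∀ {s′} → P (inj₁ s′) → Terminates s′ N) → Terminates s (suc N)
  iterate {s} {N} {P} sp halts moves acc = outcome (exec (body nextpt s)) refl (proj₁ (exec-sound sp)) (proj₂ (exec-sound sp))
    where
    outcome : ∀ r → exec (body nextpt s) ≡ r → P (proj₁ r) → proj₂ r ℕ.≤ 96 →
      ∃[ fuel ] ∃[ out ] ∃[ cost ] (loop nextpt fuel s acc ≡ just (out , cost) × IsNextpt n B p out × cost ℕ.≤ acc ℕ.+ suc N ℕ.* 96)
    outcome (inj₂ out , c) eq post c≤ = 1 , out , acc ℕ.+ c , loop-halt nextpt s acc eq , halts post , ℕP.+-monoʳ-≤ acc (ℕP.≤-trans c≤ (ℕP.m≤m+n 96 (N ℕ.* 96)))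
    outcome (inj₁ _ , c) eq post c≤ with fuel , out , cost , eq′ , nx , le ← moves post (acc ℕ.+ c) =
      suc fuel , out , cost , trans (loop-move nextpt fuel s acc eq) eq′ , nx ,
      ℕP.≤-trans le (ℕP.≤-trans (ℕP.≤-reflexive (ℕP.+-assoc acc c (N ℕ.* 96))) (ℕP.+-monoʳ-≤ acc (ℕP.+-monoˡ-≤ (N ℕ.* 96) c≤)))

  iterate-state : ∀ {u v} N → State u v →
    (∀ {u′ v′} → State u′ v′ →
      (proj₂ v < 0ℚ → proj₂ v′ ≤ proj₂ v + proj₂ v) →
      (0ℚ ≤ proj₂ v → 0ℚ ≤ proj₂ v′ → - proj₂ u′ + - proj₂ u′ ≤ - proj₂ u) → Terminates (regs u′ v′) N) →
    Terminates (regs u v) (suc N)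
  iterate-state N st next = iterate {N = N} (body-spec st) (λ { (halt nx) → nx }) (λ { (move st′ doubled halved) → next st′ doubled halved })

  -- The invariant keeps |v_y| below p_y while every iteration at least doubles it; at m = 0 the two
  -- are incompatible.
  descending : ∀ m {u v} → State u v → proj₂ v < 0ℚ → py < pow2 m * - proj₂ v → Terminates (regs u v) m
  descending zero {v = v} st vy<0 small = ⊥-elim (<⇒≱ small (bound (proj₂ v) py (pos-factor 0<n (0<px <⊞ <⇒≤ (State.0<vx st)) (State.v-in st))))
    where
    bound : ∀ vy py → 0ℚ < py + vy → 1ℚ * - vy ≤ py
    bound vy py a = cert (<⇒≤ a) (solve (vy ∷ py ∷ []) ℚ-ring)
  descending (suc m) {v = v} st vy<0 small = iterate-state m st λ {_} {v′} st′ doubled _ →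
    descending m st′ (≤-<-trans (doubled vy<0) (double-neg (proj₂ v) vy<0)) (<-≤-trans small (bound (pow2 (suc m)) (pow2 m) (proj₂ v) (proj₂ v′) (pow2-suc m) (pow2-nonneg m) (doubled vy<0)))
    where
    double-neg : ∀ y → y < 0ℚ → y + y < 0ℚ
    double-neg y a = cert< (gap< a <⊞ <⇒≤ (gap< a)) (solve (y ∷ []) ℚ-ring)
    bound : ∀ d c y y′ → d ≡ c + c → 0ℚ ≤ c → y′ ≤ y + y → d * - y ≤ c * - y′
    bound d c y y′ refl a b = cert (a ⊠ gap b) (solve (c ∷ y ∷ y′ ∷ []) ℚ-ring)

  -- Halving |u_y| cannot push it below g, which bounds this phase by m. When v_y turns negative,
  -- |v_y| ≥ g, and M doublings remain.
  rising : ∀ {g} → 0ℚ < g → YMultiples B g → ∀ M → py < pow2 M * g → ∀ m {u v} → State u v → 0ℚ ≤ proj₂ v → - proj₂ u < pow2 m * g → Terminates (regs u v) (m ℕ.+ M)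
  rising {g} 0<g mult M pyM zero {u} st 0≤vy small = ⊥-elim (<⇒≱ (subst (- proj₂ u <_) (*-identityˡ g) small) (multiple-neg 0<g (mult u (State.u∈Λ st)) (State.uy<0 st)))
  rising {g} 0<g mult M pyM (suc m) {u} {v} st 0≤vy small = iterate-state (m ℕ.+ M) st λ {u′} {v′} st′ _ halved → next st′ halved
    where
    half : ∀ d c g y y′ → d ≡ c + c → - y < d * g → - y′ + - y′ ≤ - y → - y′ < c * g
    half d c g y y′ refl a b = *-cancelˡ-<′ 2ℚ (- y′) (c * g) (positive⁻¹ 2ℚ) (cert< (gap< a <⊞ gap b) (solve (c ∷ g ∷ y ∷ y′ ∷ []) ℚ-ring))
    next : ∀ {u′ v′} → State u′ v′ → (0ℚ ≤ proj₂ v → 0ℚ ≤ proj₂ v′ → - proj₂ u′ + - proj₂ u′ ≤ - proj₂ u) → Terminates (regs u′ v′) (m ℕ.+ M)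
    next {u′} {v′} st′ halved with 0ℚ ≤? proj₂ v′
    ... | yes 0≤vy′ = rising 0<g mult M pyM m st′ 0≤vy′ (half (pow2 (suc m)) (pow2 m) g (proj₂ u) (proj₂ u′) (pow2-suc m) small (halved 0≤vy 0≤vy′))
    ... | no vy′<0 = Terminates-weaken {M = M} (ℕP.m≤n+m M m) (descending M st′ (≰⇒> vy′<0)
      (<-≤-trans pyM (*-monoˡ-≤-nonNeg (pow2 M) {{nonNegative (pow2-nonneg M)}} (multiple-neg 0<g (mult v′ (State.v∈Λ st′)) (≰⇒> vy′<0)))))

  module Start (std : IsStandardBasis B) where
    a = b1x B
    b = b1y B
    d = b2y B

    0<a : 0ℚ < a
    0<a = proj₁ std

    0<d : 0ℚ < d
    0<d = proj₁ (proj₂ std)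

    u₀ : Pt
    u₀ = 0ℚ , 0ℚ - d

    column : ℚ → Pt
    column q = a , b - q * d

    0<X : 0ℚ < px + a
    0<X = 0<px <⊞ <⇒≤ 0<a

    u₀y<0 : 0ℚ - d < 0ℚ
    u₀y<0 = neg d 0<d
      where
      neg : ∀ d → 0ℚ < d → 0ℚ - d < 0ℚ
      neg d p = cert< p (solve (d ∷ []) ℚ-ring)

    column-basis : ∀ {q} → IsIntegral q → IsBasis B u₀ (column q)
    column-basis (z , refl) = record
      { u∈Λ = + 0 , ℤ.- (+ 1) , cong₂ _,_ (u-x a) (u-y b d)
      ; v∈Λ = + 1 , ℤ.- z , cong₂ _,_ (v-x a (zℚ (ℤ.- z))) (trans (v-y b d (zℚ z)) (cong (λ c → 1ℚ * b + c * d) (sym (zℚ-neg z))))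
      ; span = λ { w (i , l , refl) → _ , zℚ i , integral-neg (integral-+ (l , refl) (integral-* (i , refl) (z , refl))) , (i , refl) ,
          cong₂ _,_ (w-x a (zℚ i) (zℚ l) (zℚ z)) (w-y b d (zℚ i) (zℚ l) (zℚ z)) }
      ; 0≤ux = ≤-refl
      ; ux<vx = 0<a
      ; det>0 = subst (0ℚ <_) (det a b d (zℚ z)) (0<a ⊠< 0<d)
      }
      where
      u-x : ∀ a → 0ℚ ≡ 0ℚ * a + - 1ℚ * 0ℚ
      u-x = solve-∀ ℚ-ring
      u-y : ∀ b d → 0ℚ - d ≡ 0ℚ * b + - 1ℚ * d
      u-y = solve-∀ ℚ-ring
      v-x : ∀ a c → a ≡ 1ℚ * a + c * 0ℚ
      v-x = solve-∀ ℚ-ring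
      v-y : ∀ b d q → b - q * d ≡ 1ℚ * b + - q * d
      v-y = solve-∀ ℚ-ring
      w-x : ∀ a i l q → i * a + l * 0ℚ ≡ - (l + i * q) * 0ℚ + i * a
      w-x = solve-∀ ℚ-ring
      w-y : ∀ b d i l q → i * b + l * d ≡ - (l + i * q) * (0ℚ - d) + i * (b - q * d)
      w-y = solve-∀ ℚ-ring
      det : ∀ a b d q → a * d ≡ 0ℚ * (b - q * d) - (0ℚ - d) * a
      det = solve-∀ ℚ-ring

    -- The largest q for which p + b₁ - q b₂ stays in H_n; one more b₂ down leaves it.
    q₀ : ℚ
    q₀ = fdivℚ ((px + a) * (py + b) - n) (d * (px + a))

    q₀-int : IsIntegral q₀
    q₀-int = fdivℚ-integral ((px + a) * (py + b) - n) (d * (px + a))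

    q₀-floor : IsFloorDiv ((px + a) * (py + b) - n) (d * (px + a)) q₀
    q₀-floor = fdivℚ-floor ((px + a) * (py + b) - n) (d * (px + a)) (0<d ⊠< 0<X)

    v₀ : Pt
    v₀ = column q₀

    v₀-in : n ≤ (px + a) * (py + proj₂ v₀)
    v₀-in = bound n px py a b d q₀ (IsFloorDiv.lower q₀-floor)
      where
      bound : ∀ n px py a b d q → q * (d * (px + a)) ≤ (px + a) * (py + b) - n → n ≤ (px + a) * (py + (b - q * d))
      bound n px py a b d q p = cert (gap p) (solve (n ∷ px ∷ py ∷ a ∷ b ∷ d ∷ q ∷ []) ℚ-ring)

    below-v₀-out : (px + a) * (py + proj₂ v₀ - d) < n
    below-v₀-out = bound n px py a b d q₀ (IsFloorDiv.upper q₀-floor)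
      where
      bound : ∀ n px py a b d q → (px + a) * (py + b) - n < (q + 1ℚ) * (d * (px + a)) → (px + a) * (py + (b - q * d) - d) < n
      bound n px py a b d q p = cert< (gap< p) (solve (n ∷ px ∷ py ∷ a ∷ b ∷ d ∷ q ∷ []) ℚ-ring)

    start-state : ¬ (n ≤ (px + 0ℚ) * (py + (0ℚ - d))) → State u₀ v₀
    start-state u-out = record
      { isBasis = column-basis q₀-int
      ; u-out = u-out
      ; u+v-out = λ f → <⇒≱ below-v₀-out (subst (n ≤_) (identity px py a (proj₂ v₀) d) f)
      ; v-in = v₀-in }
      where
      identity : ∀ px py a y d → (px + 0ℚ + 1ℚ * a) * (py + (0ℚ - d) + 1ℚ * y) ≡ (px + a) * (py + y - d)
      identity = solve-∀ ℚ-ring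

    -- The condition on p_y depends on the sign of v₀_y: if it is negative, only the ratio of p_y to
    -- |v₀_y| has to be bounded. The count always leaves room for the single iteration of the
    -- vertical case.
    terminates : ∀ {g} M → 0ℚ < g → YMultiples B g → d < pow2 M * g →
      (0ℚ ≤ proj₂ v₀ → py < pow2 M * g) → (proj₂ v₀ < 0ℚ → py < pow2 M * - proj₂ v₀) →
      Terminates (regs u₀ v₀) (suc (M ℕ.+ M))
    terminates {g} M 0<g mult dM up down with n ≤? (px + 0ℚ) * (py + (0ℚ - d))
    ... | yes u-in = iterate {N = M ℕ.+ M} (body-vertical (column-basis q₀-int) u₀y<0 u-in) id λ ()
    ... | no u-out with 0ℚ ≤? proj₂ v₀
    ...   | yes 0≤vy = Terminates-weaken {M = M ℕ.+ M} (ℕP.n≤1+n (M ℕ.+ M)) (rising 0<g mult M (up 0≤vy) M (start-state u-out) 0≤vy (subst (_< pow2 M * g) (neg-0- d) dM))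
    ...   | no vy≱0 = Terminates-weaken {M = M} (ℕP.m≤n⇒m≤1+n (ℕP.m≤m+n M M)) (descending M (start-state u-out) (≰⇒> vy≱0) (down (≰⇒> vy≱0)))

-- Termination for rational lattices and the logarithmic bound for reduced ones

YMultiples-standard : ∀ B → ∃[ g ] (0ℚ < g × YMultiples B g)
YMultiples-standard B = g , 0<g , λ { w (i , l , refl) → _ ,
    integral-+ (integral-* (i , refl) (integral-* (↥ b , refl) (↧ d , refl))) (integral-* (l , refl) (integral-* (↥ d , refl) (↧ b , refl))) ,
    trans (cong₂ (λ x y → zℚ i * x + zℚ l * y) b≡ d≡) (factor (zℚ i) (zℚ l) (zℚ (↥ b) * zℚ (↧ d)) (zℚ (↥ d) * zℚ (↧ b)) g) }
  where
  b = b1y B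
  d = b2y B
  D = zℚ (↧ b) * zℚ (↧ d)
  0<D : 0ℚ < D
  0<D = ↧-positive b ⊠< ↧-positive d
  instance
    _ = >-nonZero 0<D
  g = 1/ D
  gD≡1 : g * D ≡ 1ℚ
  gD≡1 = *-inverseˡ D
  0<g : 0ℚ < g
  0<g = pos-cancelˡ D 0<D (subst (0ℚ <_) (trans (sym gD≡1) (*-comm g D)) 0<1)
  clear : ∀ x e f g → g * (e * f) ≡ 1ℚ → x ≡ x * e * f * g
  clear x e f g eq = trans (sym (*-identityʳ x)) (trans (cong (x *_) (sym eq)) (shuffle x e f g))
    where
    shuffle : ∀ x e f g → x * (g * (e * f)) ≡ x * e * f * g
    shuffle = solve-∀ ℚ-ring
  b≡ : b ≡ zℚ (↥ b) * zℚ (↧ d) * g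
  b≡ = trans (clear b (zℚ (↧ b)) (zℚ (↧ d)) g gD≡1) (cong (λ x → x * zℚ (↧ d) * g) (*-↧≡↥ b))
  d≡ : d ≡ zℚ (↥ d) * zℚ (↧ b) * g
  d≡ = trans (clear d (zℚ (↧ d)) (zℚ (↧ b)) g (trans (cong (g *_) (*-comm (zℚ (↧ d)) (zℚ (↧ b)))) gD≡1)) (cong (λ x → x * zℚ (↧ b) * g) (*-↧≡↥ d))
  factor : ∀ i l x y g → i * (x * g) + l * (y * g) ≡ (i * x + l * y) * g
  factor = solve-∀ ℚ-ring

module _ (n px py : ℚ) (B : Basis) (std : IsStandardBasis B) (0<n : 0ℚ < n) (p∈H : InH n (px , py)) where
  open Search n px py B 0<n p∈H using (0<px; 0<py; p)
  open Run n px py B 0<n p∈H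
  open Start std

  Success : Set
  Success = ∃[ out ] ∃[ cost ] (Runs nextpt (inputs n p B) out cost × IsNextpt n B p out)

  terminating-run : Success
  terminating-run = with-multiples (YMultiples-standard B)
    where
    left< : ∀ x y → 0ℚ < y → x < x + y
    left< x y h = cert< h (solve (x ∷ y ∷ []) ℚ-ring)
    finish : ∀ {N} → Terminates (Search.regs n px py B 0<n p∈H u₀ v₀) N → Success
    finish {N} t = Terminates-sound {N = N} t 10
    with-multiples : ∃[ g ] (0ℚ < g × YMultiples B g) → Success
    with-multiples (g , 0<g , mult) = with-bound (pow2-archimedean (d + py) g 0<g)
      where
      with-bound : ∃[ M ] (d + py < pow2 M * g) → Success
      with-bound (M , big) = finish {suc (M ℕ.+ M)} (terminates M 0<g mult (<-trans (left< d py 0<py) big) (λ _ → py<)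
          (λ vy<0 → <-≤-trans py< (*-monoˡ-≤-nonNeg (pow2 M) {{nonNegative (pow2-nonneg M)}} (multiple-neg 0<g (mult v₀ (IsBasis.v∈Λ (column-basis q₀-int))) vy<0))))
        where
        py< : py < pow2 M * g
        py< = <-trans (subst (py <_) (+-comm py d) (left< py d 0<d)) big

  module _ (red : Reduced B) where
    L = logSize n B
    M = suc (suc L)

    mult : YMultiples B 1ℚ
    mult w w∈Λ with z , eq ← proj₂ (proj₁ red w w∈Λ) = zℚ z , (z , refl) , trans eq (sym (*-identityʳ (zℚ z)))

    1≤a : 1ℚ ≤ a
    1≤a = subst (_≤ a) (+-identityˡ 1ℚ) (integral-<⇒+1≤ integral-0 (proj₁ (proj₁ red v₀ (IsBasis.v∈Λ (column-basis q₀-int)))) 0<a)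

    -- From a ≥ 1 follows n + d ≤ n + det Λ < 2^(L + 1); a second factor 2 absorbs the 1, hence M =
    -- L + 2.
    size<pow2 : n + d + 1ℚ < pow2 M
    size<pow2 = subst (n + d + 1ℚ <_) (sym (pow2-suc (suc L))) (combine n a d (pow2 (suc L)) 1≤a (<⇒≤ 0<d)
      (≤-<-trans (≤-ceiling (n + detΛ B)) (≤-<-trans (zℚ-mono-≤ (i≤∣i∣ (ceiling (n + detΛ B)))) (zℚ-mono-< (ℤ.+<+ (n<2^1+log ℤ.∣ ceiling (n + detΛ B) ∣))))) (1≤pow2 (suc L)))
      where
      combine : ∀ n a d t → 1ℚ ≤ a → 0ℚ ≤ d → n + a * d < t → 1ℚ ≤ t → n + d + 1ℚ < t + t
      combine n a d t p q r s = cert< (gap< r <⊞ (gap p ⊠ q ⊞ gap s)) (solve (n ∷ a ∷ d ∷ t ∷ []) ℚ-ring)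

    -- The point p + v₀ - b₂ has a product of coordinates below n and an x-coordinate of at least 1.
    v₀-low : py + proj₂ v₀ - d < n
    v₀-low = ≰⇒> λ le → <⇒≱ below-v₀-out (scale n px a (py + proj₂ v₀ - d) (<⇒≤ 0<n) (<⇒≤ 0<px) 1≤a le)
      where
      scale : ∀ n px a y → 0ℚ ≤ n → 0ℚ ≤ px → 1ℚ ≤ a → n ≤ y → n ≤ (px + a) * y
      scale n px a y e f h i = cert ((f ⊞ gap h) ⊠ (e ⊞ gap i) ⊞ gap i) (solve (n ∷ px ∷ a ∷ y ∷ []) ℚ-ring)

    terminates-reduced : Terminates (Search.regs n px py B 0<n p∈H u₀ v₀) (suc (M ℕ.+ M))
    terminates-reduced = terminates M 0<1 mult (from-d n d (pow2 M) (<⇒≤ 0<n) size<pow2)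
      (λ 0≤vy → up n d py (proj₂ v₀) (pow2 M) 0≤vy v₀-low size<pow2)
      (λ vy<0 → down n d py (proj₂ v₀) (pow2 M) (<⇒≤ 0<n) (<⇒≤ 0<d) (multiple-neg 0<1 (mult v₀ (IsBasis.v∈Λ (column-basis q₀-int))) vy<0) v₀-low size<pow2)
      where
      from-d : ∀ n d t → 0ℚ ≤ n → n + d + 1ℚ < t → d < t * 1ℚ
      from-d n d t p q = cert< (gap< q <⊞ (p ⊞ 0≤1)) (solve (n ∷ d ∷ t ∷ []) ℚ-ring)
      up : ∀ n d py y t → 0ℚ ≤ y → py + y - d < n → n + d + 1ℚ < t → py < t * 1ℚ
      up n d py y t p q r = cert< (gap< r <⊞ (p ⊞ <⇒≤ (gap< q) ⊞ 0≤1)) (solve (n ∷ d ∷ py ∷ y ∷ t ∷ []) ℚ-ring)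
      -- The dependence on p_y disappears here: p_y < n + d + |v₀_y| ≤ (n + d + 1) |v₀_y|, because
      -- |v₀_y| ≥ 1.
      down : ∀ n d py y t → 0ℚ ≤ n → 0ℚ ≤ d → 1ℚ ≤ - y → py + y - d < n → n + d + 1ℚ < t → py < t * - y
      down n d py y t p q r s h = cert< (gap< s <⊞ ((p ⊞ q) ⊠ gap r ⊞ <⇒≤ (gap< h) ⊠ (≤-trans 0≤1 r))) (solve (n ∷ d ∷ py ∷ y ∷ t ∷ []) ℚ-ring)

    -- With 10 operations in `init` and 2 M + 1 = 2 L + 5 iterations of cost at most 96, the total
    -- is at most 490 + 192 L.
    cost-bound : ∀ out cost → Runs nextpt (inputs n p B) out cost → cost ℕ.≤ 490 ℕ.* (1 ℕ.+ L)
    cost-bound out cost (fuel , eq) = ℕP.≤-trans (Terminates-cost {N = suc (M ℕ.+ M)} terminates-reduced 10 fuel eq) (bound L)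
      where
      total : ∀ L → 10 ℕ.+ suc (suc (suc L) ℕ.+ suc (suc L)) ℕ.* 96 ℕ.+ 298 ℕ.* L ≡ 490 ℕ.* (1 ℕ.+ L)
      total = ℕ-Solver.solve-∀
      bound : ∀ L → 10 ℕ.+ suc (suc (suc L) ℕ.+ suc (suc L)) ℕ.* 96 ℕ.≤ 490 ℕ.* (1 ℕ.+ L)
      bound L = ℕP.≤-trans (ℕP.m≤m+n (10 ℕ.+ suc (suc (suc L) ℕ.+ suc (suc L)) ℕ.* 96) (298 ℕ.* L)) (ℕP.≤-reflexive (total L))

theorem3p10 : Σ Algorithm λ A →
    (∀ (n : ℚ) (p : Pt) (B : Basis) → IsStandardBasis B → 0ℚ < n → InH n p →
    ∃[ out ] ∃[ cost ] (Runs A (inputs n p B) out cost × IsNextpt n B p out))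
    × (∃[ C ] ∀ (n : ℚ) (p : Pt) (B : Basis) → IsStandardBasis B → Reduced B →
    0ℚ < n → InH n p → ¬ ((1ℚ < proj₂ p) × (proj₂ p < (1ℚ Data.Rational.+ 1ℚ))) →
    ∀ out cost → Runs A (inputs n p B) out cost → cost ℕ.≤ C ℕ.* (1 ℕ.+ logSize n B))
theorem3p10 = nextpt ,
  (λ n (px , py) B std 0<n p∈H → terminating-run n px py B std 0<n p∈H) ,
  490 , λ n (px , py) B std red 0<n p∈H _ → cost-bound n px py B std 0<n p∈H red
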